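{- Let $\lambda$ be a partition of $n$ and let $\mu=(\mu_1,\dots,\mu_k)$ be a sequence of nonnegative integers with sum $n$. The number of semistandard Young tableaux of shape $\lambda$ and weight $\mu$ is equal to the number of Semi-Noncrossing Tableaux of shape $\lambda$ and weight $\mu$.
   Context: A semistandard Young tableau of shape $\lambda$ and weight $\mu$ is a filling of the Young diagram of $\lambda$ with $\mu_i$ entries equal to $i$, weakly increasing along rows and strictly increasing down columns. Let $\lambda'=(\lambda'_1,\lambda'_2,\dots)$ be the conjugate partition of $\lambda$ (the column lengths). Two disjoint finite sets of integers $a=\{a_1<\dots<a_p\}$ and $b=\{b_1<\dots<b_q\}$ with $p\ge q$ are called non-crossing if: (1) for no $1\le i\le q-1$ does $a_i<b_i<a_{i+1}<b_{i+1}$ or $b_i<a_i<b_{i+1}<a_{i+1}$ hold; and (2) if $p>q$, then $a_q<b_q<a_{q+1}$ does not hold. A Non-Crossing Tableau (NCT) of shape $\lambda$ is a set partition of $\{1,\dots,n\}$ into pairwise non-crossing blocks (called parts) of sizes $\lambda'_1,\lambda'_2,\dots$. Divide $\{1,\dots,n\}$ into consecutive segments $B_1,\dots,B_k$ with $|B_i|=\mu_i$, i.e. $B_i=\{\mu_1+\dots+\mu_{i-1}+1,\dots,\mu_1+\dots+\mu_i\}$. Consider all NCT of shape $\lambda$ each of whose parts contains at most one element from each segment $B_i$. Call two of them equivalent if one is obtained from the other by the action of an element of the Young subgroup $S_{B_1}\times\dots\times S_{B_k}\subset S_n$ permuting the elements within the segments. The Semi-Noncrossing Tableaux of shape $\lambda$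 and weight $\mu$ are the equivalence classes. -}

module Defs where

open import Level using (0ℓ)
open import Data.Fin as Fin using (Fin; toℕ)
import Data.Fin.Properties as Fin
open import Data.Fin.Permutation as Perm using (Permutation′; _⟨$⟩ʳ_; _∘ₚ_; inverseʳ)
open import Data.Fin.Subset using (Subset; _∈_; ∣_∣)
open import Data.Fin.Subset.Properties using (_∈?_)
open import Data.List
  using (List; allFin; concat; filter; head; length; lookup; sum; tabulate; take)
open import Data.List.Relation.Unary.All using (All)
open import Data.List.Relation.Unary.Linked using (Linked)
open import Data.Maybe using (fromMaybe)
open import Data.Nat using (ℕ; suc; _+_; _≤_; _<_; _≥_; _<?_)
open import Data.Product using (∃!; ∃-syntax; _×_; _,_)
open import Function.Bundles using (Bijection; _⇔_)
open import Function.Properties.Equivalence using (⇔-isEquivalence)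
open import Relation.Binary using (IsEquivalence; Rel; Setoid)
open import Relation.Binary.PropositionalEquality
  using (_≡_; _≢_; refl; sym; trans; subst)
import Relation.Binary.PropositionalEquality.Properties as ≡
open import Relation.Nullary using (¬_)

-- The number of elements of S, counted up to the equality of S, is N.
HasCardinality : Setoid 0ℓ 0ℓ → ℕ → Set
HasCardinality S N = Bijection (≡.setoid (Fin N)) S

record Partition (n : ℕ) : Set where
  field
    parts      : List ℕ
    positive   : All (0 <_) parts
    decreasing : Linked _≥_ parts
    total      : sum parts ≡ n

  rows : ℕ
  rows = length parts

  rowLength : Fin rows → ℕ
  rowLength = lookup parts

  columns : ℕ
  columns = fromMaybe 0 (head parts)

  -- The conjugate partition; columns are indexed from 0, so column j meets
  -- exactly the rows of length > j.
  columnLength : Fin columns → ℕ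
  columnLength j = length (filter (toℕ j <?_) parts)

open Partition

-- Entries are taken from {0, …, k - 1}, where k is the length of the weight.
record SSYT {n : ℕ} (shape : Partition n) (μ : List ℕ) : Set where
  field
    entry : (r : Fin (rows shape)) → Fin (rowLength shape r) → Fin (length μ)

    rowsWeaklyIncrease :
      ∀ r {c c′} → c Fin.≤ c′ → entry r c Fin.≤ entry r c′

    columnsStrictlyIncrease :
      ∀ {r r′} → r Fin.< r′ →
      (c : Fin (rowLength shape r)) (c′ : Fin (rowLength shape r′)) →
      toℕ c ≡ toℕ c′ → entry r c Fin.< entry r′ c′

  entries : List (Fin (length μ))
  entries = concat (tabulate λ r → tabulate (entry r))

  field
    weight : ∀ i → length (filter (Fin._≟ i) entries) ≡ lookup μ i

open SSYT using (entry)

ssytSetoid : {n : ℕ} → Partition n → List ℕ → Setoid 0ℓ 0ℓ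
ssytSetoid shape μ = record
  { Carrier       = SSYT shape μ
  ; _≈_           = λ T T′ → ∀ r c → entry T r c ≡ entry T′ r c
  ; isEquivalence = record
    { refl  = λ _ _ → refl
    ; sym   = λ p r c → sym (p r c)
    ; trans = λ p q r c → trans (p r c) (q r c)
    }
  }

-- The set {1, …, n} is represented by Fin n; only its order matters.

-- In increasing order, since allFin n is increasing.
elements : {n : ℕ} → Subset n → List (Fin n)
elements {n} A = filter (_∈? A) (allFin n)

-- For a₁ < … < a_p and b₁ < … < b_q with p ≥ q; positions are counted from 0.
-- The indices i, j (and i′, j′) name equal positions in the two sequences.
record NonCrossingSequences
    {n p q : ℕ} (a : Fin p → Fin n) (b : Fin q → Fin n) : Set where
  field
    noInterleaving :
      ∀ {i i′ : Fin p} {j j′ : Fin q} →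
      toℕ i ≡ toℕ j → toℕ i′ ≡ suc (toℕ i) → toℕ j′ ≡ suc (toℕ j) →
      ¬ (a i Fin.< b j × b j Fin.< a i′ × a i′ Fin.< b j′) ×
      ¬ (b j Fin.< a i × a i Fin.< b j′ × b j′ Fin.< a i′)

    -- Here a i = a_q, b j = b_q and a i′ = a_{q+1}.
    noFinalInterleaving :
      q < p →
      ∀ {i i′ : Fin p} {j : Fin q} →
      toℕ i ≡ toℕ j → suc (toℕ j) ≡ q → toℕ i′ ≡ q →
      ¬ (a i Fin.< b j × b j Fin.< a i′)

-- To be used only when A has at least as many elements as B.
NonCrossing : {n : ℕ} → Subset n → Subset n → Set
NonCrossing A B = NonCrossingSequences (lookup (elements A)) (lookup (elements B))

-- The blocks of the set partition are labelled by the columns of the shape;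
-- the labelling is forgotten by the equivalence _∼_ below.
record NCT {n : ℕ} (shape : Partition n) : Set where
  field
    part        : Fin (columns shape) → Subset n
    partitions  : ∀ x → ∃! _≡_ λ j → x ∈ part j
    sizes       : ∀ j → ∣ part j ∣ ≡ columnLength shape j
    nonCrossing : ∀ {i j} → i ≢ j → ∣ part j ∣ ≤ ∣ part i ∣ →
                  NonCrossing (part i) (part j)

open NCT using (part)

-- x ∈ B_i, with the elements of {1, …, n} shifted to start from 0.
_∈Segment[_,_] : {n : ℕ} → Fin n → (μ : List ℕ) → Fin (length μ) → Set
x ∈Segment[ μ , i ] = start ≤ toℕ x × toℕ x < start + lookup μ i
  where start = sum (take (toℕ i) μ)

Transversal : {n : ℕ} {shape : Partition n} → List ℕ → NCT shape → Set
Transversal μ T =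
  ∀ j i {x y} → x ∈ part T j → y ∈ part T j →
  x ∈Segment[ μ , i ] → y ∈Segment[ μ , i ] → x ≡ y

InYoungSubgroup : {n : ℕ} → List ℕ → Permutation′ n → Set
InYoungSubgroup μ σ = ∀ i x → x ∈Segment[ μ , i ] ⇔ (σ ⟨$⟩ʳ x) ∈Segment[ μ , i ]

-- T′ is the image of T under σ, as an unlabelled set partition: the blocks
-- of T′ are, in some order, the images under σ of the blocks of T.
IsImage : {n : ℕ} {shape : Partition n} → Permutation′ n → Rel (NCT shape) 0ℓ
IsImage {shape = shape} σ T T′ =
  ∃[ τ ] ∀ j x → x ∈ part T j ⇔ (σ ⟨$⟩ʳ x) ∈ part T′ (τ ⟨$⟩ʳ j)

record TransversalNCT {n : ℕ} (shape : Partition n) (μ : List ℕ) : Set where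
  field
    nct         : NCT shape
    transversal : Transversal μ nct

open TransversalNCT using (nct)

module _ {n : ℕ} {shape : Partition n} {μ : List ℕ} where

  private module ⇔ {ℓ} = IsEquivalence (⇔-isEquivalence {ℓ})

  infix 4 _∼_

  _∼_ : Rel (TransversalNCT shape μ) 0ℓ
  T ∼ T′ = ∃[ σ ] InYoungSubgroup μ σ × IsImage σ (nct T) (nct T′)

  private
    ∼-refl : ∀ {T} → T ∼ T
    ∼-refl = Perm.id , (λ _ _ → ⇔.refl) , Perm.id , λ _ _ → ⇔.refl

    ∼-sym : ∀ {T T′} → T ∼ T′ → T′ ∼ T
    ∼-sym {T} {T′} (σ , σ∈ , τ , image) =
      Perm.flip σ
      , (λ i x → ⇔.sym (subst
          (λ y → (Perm.flip σ ⟨$⟩ʳ x) ∈Segment[ μ , i ] ⇔ y ∈Segment[ μ , i ])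
          (inverseʳ σ) (σ∈ i (Perm.flip σ ⟨$⟩ʳ x))))
      , Perm.flip τ
      , λ j x → ⇔.sym (subst
          (λ k → (Perm.flip σ ⟨$⟩ʳ x) ∈ part (nct T) (Perm.flip τ ⟨$⟩ʳ j)
                 ⇔ x ∈ part (nct T′) k)
          (inverseʳ τ)
          (subst
            (λ y → (Perm.flip σ ⟨$⟩ʳ x) ∈ part (nct T) (Perm.flip τ ⟨$⟩ʳ j)
                   ⇔ y ∈ part (nct T′) (τ ⟨$⟩ʳ (Perm.flip τ ⟨$⟩ʳ j)))
            (inverseʳ σ)
            (image (Perm.flip τ ⟨$⟩ʳ j) (Perm.flip σ ⟨$⟩ʳ x))))

    ∼-trans : ∀ {T T′ T″} → T ∼ T′ → T′ ∼ T″ → T ∼ T″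
    ∼-trans (σ , σ∈ , τ , image) (σ′ , σ′∈ , τ′ , image′) =
      σ ∘ₚ σ′
      , (λ i x → ⇔.trans (σ∈ i x) (σ′∈ i (σ ⟨$⟩ʳ x)))
      , τ ∘ₚ τ′
      , λ j x → ⇔.trans (image j x) (image′ (τ ⟨$⟩ʳ j) (σ ⟨$⟩ʳ x))

  ∼-isEquivalence : IsEquivalence _∼_
  ∼-isEquivalence = record
    { refl  = λ {T} → ∼-refl {T}
    ; sym   = λ {T} {T′} → ∼-sym {T} {T′}
    ; trans = λ {T} {T′} {T″} → ∼-trans {T} {T′} {T″}
    }

-- Semi-Noncrossing Tableaux: the quotient by _∼_, presented as a setoid.
semiNCTSetoid : {n : ℕ} → Partition n → List ℕ → Setoid 0ℓ 0ℓ
semiNCTSetoid shape μ = record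
  { Carrier       = TransversalNCT shape μ
  ; _≈_           = _∼_
  ; isEquivalence = ∼-isEquivalence
  }

-- Say that an element is in row r if it is the r-th smallest of its part. For
-- fixed r, the non-crossing conditions state that the elements of row r + 1 are
-- joined to those of row r like closing brackets to their matching opening
-- brackets, so a non-crossing tableau is determined by its rows. Replacing each
-- element by its segment and sorting the rows gives a semistandard tableau: a part
-- meets each segment at most once, so the element above x lies in an earlier segment
-- than x. Conversely, if x < y lie in one segment, in rows r and r + 1, then y is
-- matched with some element before the segment, so x is matched before y, inside the
-- segment, which is impossible. Hence in every segment row r + 1 precedes row r, and
-- the entries of the semistandard tableau determine the order of any two adjacent
-- rows, hence the matching, up to permutations of the segments.

module Submission where

open import Defs
open import Data.Bool using (true)
open import Data.Fin as Fin using (Fin; zero; suc; toℕ; fromℕ<; cast; punchIn; punchOut; _↑ˡ_; _↑ʳ_)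
open import Data.Fin.Induction using (<-wellFounded; Acc; acc)
import Data.Fin.Properties as Fin
open import Data.Fin.Permutation as Perm using (_⟨$⟩ʳ_; _⟨$⟩ˡ_)
open import Data.Fin.Subset as Subset using (Subset; ∣_∣)
import Data.Fin.Subset.Properties as Subset
open import Data.List
  using (List; []; _∷_; _++_; head; allFin; concat; filter; length; lookup; map; sum; tabulate; take)
import Data.List.Properties as List
open import Data.List.Membership.Propositional using (_∈_)
import Data.List.Membership.Propositional.Properties as ∈
open import Data.List.Membership.Propositional.Properties.WithK using (unique∧set⇒bag)
open import Data.List.Relation.Binary.BagAndSetEquality using (∼bag⇒↭)
open import Data.List.Relation.Binary.Permutation.Propositional using (_↭_)
import Data.List.Relation.Binary.Permutation.Propositional.Properties as ↭
open import Data.List.Relation.Unary.All as All using (All; []; _∷_)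
open import Data.List.Relation.Unary.AllPairs as AllPairs using (AllPairs; []; _∷_)
import Data.List.Relation.Unary.AllPairs.Properties as AllPairs
import Data.List.Relation.Unary.Any as Any
import Data.List.Relation.Unary.Any.Properties as Any
import Data.List.Relation.Unary.Linked.Properties as Linked
open import Data.List.Relation.Unary.Unique.Propositional using (Unique)
import Data.List.Relation.Unary.Unique.Propositional.Properties as Unique
open import Data.Maybe using (fromMaybe)
open import Data.Nat as ℕ using (ℕ; zero; suc; _+_; _≤_; _<_; z≤n; s≤s)
import Data.Nat.Properties as ℕ
open import Data.Product using (Σ; ∃; ∃-syntax; _×_; _,_; proj₁; proj₂)
open import Data.Product.Properties.WithK using (,-injectiveʳ)
open import Data.Sum using (_⊎_; inj₁; inj₂)
import Data.Vec as Vec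
import Data.Vec.Properties as Vec
open import Function using (case_of_; _∘_; id; _⇔_; mk⇔; Bijection; Equivalence; Injective)
open import Level using (0ℓ)
open import Relation.Binary using (Setoid)
open import Relation.Binary.Definitions using (tri<; tri≈; tri>)
open import Relation.Binary.PropositionalEquality
  using (_≡_; _≢_; refl; sym; trans; cong; cong₂; subst; subst₂; module ≡-Reasoning)
open import Relation.Nullary using (¬_; Dec; yes; no; does; contradiction)
open import Relation.Nullary.Decidable using (_×-dec_; _→-dec_)
open import Relation.Unary using (Decidable)

-- The definitions speak of blocks, and the equivalence moves elements without mentioning rows.
-- `Layout` translates between the two views: each element receives a row and a column, and both
-- non-crossing conditions become the single field `cover`, condition (2) being the case where the
-- other block stops too early. An equivalence respects rows because a block meets each segment at
-- most once: a permutation that keeps every segment also keeps the order inside every block.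
--
-- Two choices shape the construction of blocks from a tableau. Equal entries are numbered from the
-- bottom row up, so for an element of a row and one of the next row, coming earlier means exactly
-- having the smaller entry. Columns are also labelled from the bottom row up: every element of the
-- lower row needs a partner, while the surplus of the longer upper row consists of column ends.
-- Column strictness is what keeps the greedy choice of partners from getting stuck.
--
-- The common cardinality comes from the tableau side, where being semistandard is decidable among
-- finitely many fillings.

private variable
  k m n : ℕ

-- Lists of elements of Fin k

count : Fin k → List (Fin k) → ℕ
count i xs = length (filter (Fin._≟ i) xs)

count-∷≡ : ∀ (i : Fin k) xs → count i (i ∷ xs) ≡ suc (count i xs)
count-∷≡ i xs = cong length (List.filter-accept (Fin._≟ i) refl)

count-∷≢ : ∀ {i j : Fin k} xs → j ≢ i → count i (j ∷ xs) ≡ count i xs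
count-∷≢ {i = i} xs j≢i = cong length (List.filter-reject (Fin._≟ i) j≢i)

count-above : ∀ {i : Fin k} {xs} → All (i Fin.<_) xs → count i xs ≡ 0
count-above []           = refl
count-above (i<x ∷ i<xs) = trans (count-∷≢ _ (Fin.<⇒≢ i<x ∘ sym)) (count-above i<xs)

count-↭ : ∀ {xs ys : List (Fin k)} → xs ↭ ys → ∀ i → count i xs ≡ count i ys
count-↭ xs↭ys i = ↭.↭-length (↭.filter-↭ (Fin._≟ i) xs↭ys)

count-tail : ∀ (x : Fin k) {xs ys} → (∀ i → count i (x ∷ xs) ≡ count i (x ∷ ys)) →
             ∀ i → count i xs ≡ count i ys
count-tail x {xs} {ys} same i with x Fin.≟ i
... | yes refl = ℕ.suc-injective (trans (sym (count-∷≡ x xs)) (trans (same x) (count-∷≡ x ys)))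
... | no x≢i = trans (sym (count-∷≢ xs x≢i)) (trans (same i) (count-∷≢ ys x≢i))

-- If `x` were smaller, it would lie below every entry of `y ∷ ys` and have count 0 there, although
-- it heads the other list.
sorted-head-minimal : ∀ {x y : Fin k} {xs ys} → All (y Fin.≤_) ys →
                      count x (x ∷ xs) ≡ count x (y ∷ ys) → ¬ (x Fin.< y)
sorted-head-minimal {x = x} {xs = xs} y≤ys same x<y =
  ℕ.1+n≢0 (trans (sym (count-∷≡ x xs))
    (trans same (count-above (x<y ∷ All.map (ℕ.<-≤-trans x<y) y≤ys))))

-- Each head is bounded below by the other, so the heads agree and can be cancelled from the counts.
-- This is how rows of tableaux are compared: sorted rows are equal once their contents are.
sorted-unique : ∀ {xs ys : List (Fin k)} → AllPairs Fin._≤_ xs → AllPairs Fin._≤_ ys →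
                (∀ i → count i xs ≡ count i ys) → xs ≡ ys
sorted-unique {xs = []} {[]} _ _ _ = refl
sorted-unique {xs = []} {y ∷ ys} _ _ same =
  contradiction (trans (same y) (count-∷≡ y ys)) λ ()
sorted-unique {xs = x ∷ xs} {[]} _ _ same =
  contradiction (trans (sym (same x)) (count-∷≡ x xs)) λ ()
sorted-unique {xs = x ∷ xs} {y ∷ ys} (x≤xs ∷ xs↗) (y≤ys ∷ ys↗) same
  with refl ← Fin.≤-antisym
    (ℕ.≮⇒≥ (sorted-head-minimal x≤xs (sym (same y))))
    (ℕ.≮⇒≥ (sorted-head-minimal y≤ys (same x)))
  = cong (x ∷_) (sorted-unique xs↗ ys↗ (count-tail x same))

unique-↭ : ∀ {A : Set} {xs ys : List A} → Unique xs → Unique ys →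
           (∀ {x} → x ∈ xs → x ∈ ys) → (∀ {x} → x ∈ ys → x ∈ xs) → xs ↭ ys
unique-↭ xs! ys! to from = ∼bag⇒↭ (unique∧set⇒bag xs! ys! (mk⇔ to from))

increasing-unique : ∀ {xs ys : List (Fin k)} → AllPairs Fin._<_ xs → AllPairs Fin._<_ ys →
                    (∀ {x} → x ∈ xs → x ∈ ys) → (∀ {x} → x ∈ ys → x ∈ xs) → xs ≡ ys
increasing-unique xs↗ ys↗ to from =
  sorted-unique (AllPairs.map ℕ.<⇒≤ xs↗) (AllPairs.map ℕ.<⇒≤ ys↗)
    (count-↭ (unique-↭ (AllPairs.map Fin.<⇒≢ xs↗) (AllPairs.map Fin.<⇒≢ ys↗) to from))

allFin-increasing : ∀ n → AllPairs Fin._<_ (allFin n)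
allFin-increasing n = AllPairs.tabulate⁺-< id

filter-increasing : ∀ {P : Fin n → Set} (P? : Decidable P) →
                    AllPairs Fin._<_ (filter P? (allFin n))
filter-increasing P? = AllPairs.filter⁺ P? (allFin-increasing _)

∈-filter-allFin : ∀ {P : Fin n → Set} (P? : Decidable P) {x} →
                  P x → x ∈ filter P? (allFin n)
∈-filter-allFin P? Px = ∈.∈-filter⁺ P? (∈.∈-allFin _) Px

filter-allFin-holds : ∀ {P : Fin n → Set} (P? : Decidable P) {x} →
                      x ∈ filter P? (allFin n) → P x
filter-allFin-holds P? = proj₂ ∘ ∈.∈-filter⁻ P? {xs = allFin _}

-- Both lists are increasing and have the same elements. Segments, parts and rows are all given by
-- `filter`; this replaces them by explicit enumerations.
filter-enumeration : ∀ {P : Fin n → Set} (P? : Decidable P) (f : Fin m → Fin n) →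
                     (∀ {i j} → i Fin.< j → f i Fin.< f j) →
                     (∀ i → P (f i)) → (∀ {x} → P x → ∃[ i ] f i ≡ x) →
                     filter P? (allFin n) ≡ tabulate f
filter-enumeration {P = P} P? f f-mono Pf surj =
  increasing-unique (filter-increasing P?) (AllPairs.tabulate⁺-< f-mono)
    (λ x∈ → let i , fi≡x = surj (filter-allFin-holds P? x∈) in
            subst (_∈ tabulate f) fi≡x (∈.∈-tabulate⁺ i))
    (λ x∈ → let i , x≡fi = ∈.∈-tabulate⁻ x∈ in
            ∈-filter-allFin P? (subst P (sym x≡fi) (Pf i)))

lookup-≡ : ∀ {A : Set} {xs ys : List A} → xs ≡ ys → ∀ {i j} → toℕ i ≡ toℕ j →
           lookup xs i ≡ lookup ys j
lookup-≡ {xs = xs} refl i≡j = cong (lookup xs) (Fin.toℕ-injective i≡j)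

lookup-increasing : ∀ (xs : List (Fin k)) → AllPairs Fin._<_ xs →
                    ∀ {i j} → i Fin.< j → lookup xs i Fin.< lookup xs j
lookup-increasing (_ ∷ _)  (x<xs ∷ _)  {zero}  {suc j} _         = All.lookup x<xs (∈.∈-lookup j)
lookup-increasing (_ ∷ xs) (_ ∷ xs↗)   {suc i} {suc j} (s≤s i<j) = lookup-increasing xs xs↗ i<j

lookup-tabulate′ : ∀ {A : Set} (f : Fin n → A) {i : Fin (length (tabulate f))} {j} →
                   toℕ i ≡ toℕ j → lookup (tabulate f) i ≡ f j
lookup-tabulate′ f {i} {j} i≡j =
  trans (lookup-≡ {xs = tabulate f} refl (trans i≡j (sym (Fin.toℕ-cast _ j)))) (List.lookup-tabulate f j)

lookup-map′ : ∀ {A B : Set} (f : A → B) {xs : List A}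
              {i : Fin (length (map f xs))} {j} →
              toℕ i ≡ toℕ j → lookup (map f xs) i ≡ f (lookup xs j)
lookup-map′ f {_ ∷ _} {zero}  {zero}  _   = refl
lookup-map′ f {_ ∷ xs} {suc i} {suc j} i≡j = lookup-map′ f {xs} (ℕ.suc-injective i≡j)

increasing⇒injective : ∀ {f : Fin m → Fin n} → (∀ {i j} → i Fin.< j → f i Fin.< f j) →
                       Injective _≡_ _≡_ f
increasing⇒injective f-mono {i} {j} fi≡fj with Fin.<-cmp i j
... | tri< i<j _ _ = contradiction fi≡fj (Fin.<⇒≢ (f-mono i<j))
... | tri≈ _ i≡j _ = i≡j
... | tri> _ _ j<i = contradiction (sym fi≡fj) (Fin.<⇒≢ (f-mono j<i))

increasing-reflects : ∀ {f : Fin m → Fin n} → (∀ {i j} → i Fin.< j → f i Fin.< f j) →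
                      ∀ {i j} → f i Fin.< f j → i Fin.< j
increasing-reflects f-mono {i} {j} fi<fj with Fin.<-cmp i j
... | tri< i<j _ _ = i<j
... | tri≈ _ refl _ = contradiction fi<fj (ℕ.<-irrefl refl)
... | tri> _ _ j<i = contradiction fi<fj (ℕ.<-asym (f-mono j<i))

injective⇒surjective : ∀ {f : Fin n → Fin n} → Injective _≡_ _≡_ f → ∀ y → ∃[ x ] f x ≡ y
injective⇒surjective {suc n} {f} f-inj y with Fin.any? (λ x → f x Fin.≟ y)
... | yes found = found
... | no missed =
  let y≢f = λ x y≡fx → missed (x , sym y≡fx)
      i , j , i<j , eq = Fin.pigeonhole (ℕ.n<1+n n) (λ x → punchOut (y≢f x))
  in contradiction (f-inj (Fin.punchOut-injective (y≢f i) (y≢f j) eq)) (Fin.<⇒≢ i<j)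

tabulate-↭ : ∀ {f : Fin n → Fin n} → Injective _≡_ _≡_ f → tabulate f ↭ allFin n
tabulate-↭ {f = f} f-inj = unique-↭ (Unique.tabulate⁺ f-inj) (Unique.allFin⁺ _)
  (λ _ → ∈.∈-allFin _)
  (λ {x} _ → let i , fi≡x = injective⇒surjective f-inj x in
             subst (_∈ tabulate f) fi≡x (∈.∈-tabulate⁺ i))

-- Subsets

comprehension : {P : Fin n → Set} → Decidable P → Subset n
comprehension P? = Vec.tabulate (does ∘ P?)

∈-comprehension⁺ : ∀ {P : Fin n → Set} (P? : Decidable P) {x} →
                   P x → x Subset.∈ comprehension P?
∈-comprehension⁺ P? {x} Px = Vec.lookup⇒[]= x _ (trans (Vec.lookup∘tabulate _ x) does≡true)
  where
  does≡true : does (P? x) ≡ true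
  does≡true with P? x
  ... | yes _  = refl
  ... | no ¬Px = contradiction Px ¬Px

∈-comprehension⁻ : ∀ {P : Fin n → Set} (P? : Decidable P) {x} →
                   x Subset.∈ comprehension P? → P x
∈-comprehension⁻ P? {x} x∈ with P? x | trans (sym (Vec.lookup∘tabulate _ x)) (Vec.[]=⇒lookup x∈)
... | yes Px | _ = Px
... | no _   | ()

-- The induction is on a tail `B` of `A`, placed inside `Fin n` by `f`, while the list stays
-- filtered by the whole of `A`.
length-elements : ∀ (A : Subset n) → length (elements A) ≡ ∣ A ∣
length-elements {n} A = go A id (λ {x} → mk⇔ id id)
  where
  go : ∀ {m} (B : Subset m) (f : Fin m → Fin n) → (∀ {x} → x Subset.∈ B ⇔ f x Subset.∈ A) →
       length (filter (Subset._∈? A) (tabulate f)) ≡ ∣ B ∣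
  go Vec.[] f _ = refl
  go (Subset.inside Vec.∷ B) f f∈ = trans
    (cong length (List.filter-accept (Subset._∈? A) (Equivalence.to f∈ Vec.here)))
    (cong suc (go B (f ∘ suc) (mk⇔ (Equivalence.to f∈ ∘ Vec.there)
                                   (Subset.drop-there ∘ Equivalence.from f∈))))
  go (Subset.outside Vec.∷ B) f f∈ = trans
    (cong length (List.filter-reject (Subset._∈? A) (λ f0∈A → case Equivalence.from f∈ f0∈A of λ ())))
    (go B (f ∘ suc) (mk⇔ (Equivalence.to f∈ ∘ Vec.there)
                         (Subset.drop-there ∘ Equivalence.from f∈)))

-- Segments

count-map : ∀ {A : Set} (f : A → Fin k) i xs →
            count i (map f xs) ≡ length (filter (λ x → f x Fin.≟ i) xs)
count-map f i [] = refl
count-map f i (x ∷ xs) with f x Fin.≟ i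
... | yes _ = cong suc (count-map f i xs)
... | no _  = count-map f i xs

segmentStart : (μ : List ℕ) → Fin (length μ) → ℕ
segmentStart μ i = sum (take (toℕ i) μ)

segmentStart-< : ∀ μ {i j : Fin (length μ)} → i Fin.< j →
                 segmentStart μ i + lookup μ i ≤ segmentStart μ j
segmentStart-< (m ∷ μ) {zero}  {suc j} _ = ℕ.m≤m+n m _
segmentStart-< (m ∷ μ) {suc i} {suc j} (s≤s i<j) =
  ℕ.≤-trans (ℕ.≤-reflexive (ℕ.+-assoc m _ _)) (ℕ.+-monoʳ-≤ m (segmentStart-< μ i<j))

segmentEnd-≤ : ∀ μ (i : Fin (length μ)) → segmentStart μ i + lookup μ i ≤ sum μ
segmentEnd-≤ (m ∷ μ) zero    = ℕ.m≤m+n m _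
segmentEnd-≤ (m ∷ μ) (suc i) =
  ℕ.≤-trans (ℕ.≤-reflexive (ℕ.+-assoc m _ _)) (ℕ.+-monoʳ-≤ m (segmentEnd-≤ μ i))

segment-exists : ∀ μ {x} → x < sum μ →
                 ∃[ i ] (segmentStart μ i ≤ x × x < segmentStart μ i + lookup μ i)
segment-exists (m ∷ μ) {x} x<m+Σ with x ℕ.<? m
... | yes x<m = zero , z≤n , x<m
... | no x≮m =
  let m≤x = ℕ.≮⇒≥ x≮m
      m+[x∸m]≡x = ℕ.m+[n∸m]≡n m≤x
      i , start≤ , <end = segment-exists μ
        (ℕ.+-cancelˡ-< m _ _ (ℕ.≤-<-trans (ℕ.≤-reflexive m+[x∸m]≡x) x<m+Σ))
  in suc i
   , ℕ.≤-trans (ℕ.+-monoʳ-≤ m start≤) (ℕ.≤-reflexive m+[x∸m]≡x)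
   , ℕ.<-≤-trans (ℕ.≤-<-trans (ℕ.≤-reflexive (sym m+[x∸m]≡x)) (ℕ.+-monoʳ-< m <end))
       (ℕ.≤-reflexive (sym (ℕ.+-assoc m _ _)))

module Segments (μ : List ℕ) {n} (total : sum μ ≡ n) where

  private
    exists : (x : Fin n) → ∃[ i ] (x ∈Segment[ μ , i ])
    exists x = segment-exists μ (subst (toℕ x <_) (sym total) (Fin.toℕ<n x))

  segment : Fin n → Fin (length μ)
  segment x = proj₁ (exists x)

  ∈-segment : ∀ x → x ∈Segment[ μ , segment x ]
  ∈-segment x = proj₂ (exists x)

  segments-ordered : ∀ {x y : Fin n} {i j} → x ∈Segment[ μ , i ] → y ∈Segment[ μ , j ] →
                     x Fin.≤ y → i Fin.≤ j
  segments-ordered (start≤x , _) (_ , y<end) x≤y = ℕ.≮⇒≥ λ j<i →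
    ℕ.<-irrefl refl (ℕ.<-≤-trans y<end
      (ℕ.≤-trans (segmentStart-< μ j<i) (ℕ.≤-trans start≤x x≤y)))

  segment-mono : ∀ {x y : Fin n} → x Fin.≤ y → segment x Fin.≤ segment y
  segment-mono = segments-ordered (∈-segment _) (∈-segment _)

  segment-reflects-< : ∀ {x y : Fin n} → segment x Fin.< segment y → x Fin.< y
  segment-reflects-< sx<sy = ℕ.≰⇒> λ y≤x → ℕ.<⇒≱ sx<sy (segment-mono y≤x)

  segment-unique : ∀ {x : Fin n} {i} → x ∈Segment[ μ , i ] → segment x ≡ i
  segment-unique x∈i = Fin.≤-antisym
    (segments-ordered (∈-segment _) x∈i ℕ.≤-refl) (segments-ordered x∈i (∈-segment _) ℕ.≤-refl)

  segment-≡ : ∀ {x : Fin n} {i} → segment x ≡ i → x ∈Segment[ μ , i ]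
  segment-≡ refl = ∈-segment _

  count-segment : ∀ i → count i (tabulate segment) ≡ lookup μ i
  count-segment i = begin
    count i (tabulate segment)
      ≡⟨ cong (count i) (List.map-tabulate id segment) ⟨
    count i (map segment (allFin n))
      ≡⟨ count-map segment i (allFin n) ⟩
    length (filter (λ x → segment x Fin.≟ i) (allFin n))
      ≡⟨ cong length (filter-enumeration (λ x → segment x Fin.≟ i) element element-mono
           (λ t → segment-unique (ℕ.≤-trans (ℕ.m≤m+n _ _) (ℕ.≤-reflexive (sym (toℕ-element t)))
                                 , ℕ.≤-<-trans (ℕ.≤-reflexive (toℕ-element t))
                                     (ℕ.+-monoʳ-< _ (Fin.toℕ<n t))))
           element-surjective) ⟩
    length (tabulate element)
      ≡⟨ List.length-tabulate element ⟩
    lookup μ i ∎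
    where
    open ≡-Reasoning

    element-< : (t : Fin (lookup μ i)) → segmentStart μ i + toℕ t < n
    element-< t = ℕ.<-≤-trans (ℕ.+-monoʳ-< _ (Fin.toℕ<n t))
      (ℕ.≤-trans (segmentEnd-≤ μ i) (ℕ.≤-reflexive total))

    element : Fin (lookup μ i) → Fin n
    element t = fromℕ< (element-< t)

    toℕ-element : ∀ t → toℕ (element t) ≡ segmentStart μ i + toℕ t
    toℕ-element t = Fin.toℕ-fromℕ< (element-< t)

    element-mono : ∀ {t u} → t Fin.< u → element t Fin.< element u
    element-mono {t} {u} t<u rewrite toℕ-element t | toℕ-element u = ℕ.+-monoʳ-< _ t<u

    element-surjective : ∀ {x} → segment x ≡ i → ∃[ t ] element t ≡ x
    element-surjective {x} refl with start≤x , x<end ← ∈-segment x =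
      fromℕ< t<μᵢ , Fin.toℕ-injective (begin
        toℕ (element (fromℕ< t<μᵢ))              ≡⟨ toℕ-element _ ⟩
        segmentStart μ i + toℕ (fromℕ< t<μᵢ)     ≡⟨ cong (segmentStart μ i +_) (Fin.toℕ-fromℕ< t<μᵢ) ⟩
        segmentStart μ i + (toℕ x ℕ.∸ segmentStart μ i) ≡⟨ ℕ.m+[n∸m]≡n start≤x ⟩
        toℕ x ∎)
      where
      t<μᵢ : toℕ x ℕ.∸ segmentStart μ i < lookup μ i
      t<μᵢ = ℕ.+-cancelˡ-< (segmentStart μ i) _ _
        (ℕ.≤-<-trans (ℕ.≤-reflexive (ℕ.m+[n∸m]≡n start≤x)) x<end)

-- Non-crossing tableaux by coordinates

-- Both sides say that the cell in row `r` and column `j` lies in the diagram: the parts decrease,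
-- so the rows longer than `j` form an initial run and their number marks its end.
columnHeight : ∀ {ps} → AllPairs ℕ._≥_ ps → ∀ j (r : Fin (length ps)) →
               toℕ r < length (filter (j ℕ.<?_) ps) ⇔ j < lookup ps r
columnHeight {p ∷ ps} (p≥ps ∷ ps↘) j r with j ℕ.<? p
... | yes j<p rewrite List.filter-accept (j ℕ.<?_) {xs = ps} j<p = accepted r
  where
  accepted : ∀ r → toℕ r < suc (length (filter (j ℕ.<?_) ps)) ⇔ j < lookup (p ∷ ps) r
  accepted zero    = mk⇔ (λ _ → j<p) (λ _ → s≤s z≤n)
  accepted (suc r) = mk⇔ (Equivalence.to ih ∘ ℕ.s≤s⁻¹) (s≤s ∘ Equivalence.from ih)
    where ih = columnHeight ps↘ j r
... | no j≮p rewrite List.filter-reject (j ℕ.<?_) {xs = ps} j≮p =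
  mk⇔ (λ r<h → contradiction (subst (toℕ r <_) (cong length none) r<h) ℕ.n≮0)
      (λ j<q → contradiction (ℕ.<-≤-trans j<q (q≤p r)) j≮p)
  where
  none : filter (j ℕ.<?_) ps ≡ []
  none = List.filter-none (j ℕ.<?_) (All.map (λ p≥q j<q → j≮p (ℕ.<-≤-trans j<q p≥q)) p≥ps)

  q≤p : ∀ r → lookup (p ∷ ps) r ≤ p
  q≤p zero    = ℕ.≤-refl
  q≤p (suc r) = All.lookup p≥ps (∈.∈-lookup r)

lookup-antitone : ∀ {ps} → AllPairs ℕ._≥_ ps → ∀ {r r′ : Fin (length ps)} → r Fin.≤ r′ →
                  lookup ps r′ ≤ lookup ps r
lookup-antitone (_ ∷ _)    {zero}  {zero}   _          = ℕ.≤-refl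
lookup-antitone (p≥ps ∷ _) {zero}  {suc r′} _          = All.lookup p≥ps (∈.∈-lookup r′)
lookup-antitone (_ ∷ ps↘)  {suc r} {suc r′} (s≤s r≤r′) = lookup-antitone ps↘ r≤r′

module Shape {n : ℕ} (shape : Partition n) where

  open Partition shape public

  parts-decreasing : AllPairs ℕ._≥_ parts
  parts-decreasing = Linked.Linked⇒AllPairs (λ p≥q q≥r → ℕ.≤-trans q≥r p≥q) decreasing

  rowLength-antitone : ∀ {r r′} → r Fin.≤ r′ → rowLength r′ ≤ rowLength r
  rowLength-antitone = lookup-antitone parts-decreasing

  columnLength-rowLength : ∀ j r → toℕ r < columnLength j ⇔ toℕ j < rowLength r
  columnLength-rowLength j r = columnHeight parts-decreasing (toℕ j) r

  columnLength≤rows : ∀ j → columnLength j ≤ rows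
  columnLength≤rows j = List.length-filter (toℕ j ℕ.<?_) parts

  rowLength≤columns : ∀ r → rowLength r ≤ columns
  rowLength≤columns r = ≤head parts-decreasing r
    where
    ≤head : ∀ {ps} → AllPairs ℕ._≥_ ps → ∀ r → lookup ps r ≤ fromMaybe 0 (head ps)
    ≤head {_ ∷ _} ps↘ r = lookup-antitone ps↘ {zero} {r} z≤n

  firstRow : (j : Fin columns) → ∃[ r ] toℕ j < rowLength r
  firstRow j = first parts j
    where
    first : ∀ ps (j : Fin (fromMaybe 0 (head ps))) → ∃[ r ] toℕ j < lookup ps r
    first (p ∷ ps) j = zero , Fin.toℕ<n j

  -- Write ( for the elements of row r and ) for those of row r + 1: the condition
  -- cover says that each part joins a ) to the ( matching it.
  record Layout : Set where
    field
      row        : Fin n → Fin rows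
      col        : Fin n → Fin columns
      fits       : ∀ x → toℕ (col x) < rowLength (row x)
      place      : ∀ r j → toℕ j < rowLength r → ∃[ x ] (row x ≡ r × col x ≡ j)
      separate   : ∀ {x y} → row x ≡ row y → col x ≡ col y → x ≡ y
      increasing : ∀ {x y} → col x ≡ col y → row x Fin.< row y → x Fin.< y
      cover      : ∀ {x y z} → col x ≡ col y → toℕ (row y) ≡ suc (toℕ (row x)) →
                   row z ≡ row x → x Fin.< z → z Fin.< y →
                   ∃[ w ] (col w ≡ col z × row w ≡ row y × w Fin.< y)

    above : ∀ {r} x → r Fin.≤ row x → ∃[ y ] (row y ≡ r × col y ≡ col x)
    above x r≤x = place _ (col x) (ℕ.<-≤-trans (fits x) (rowLength-antitone r≤x))

    increasing⁻¹ : ∀ {x y} → col x ≡ col y → x Fin.< y → row x Fin.< row y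
    increasing⁻¹ {x} {y} cx≡cy x<y with Fin.<-cmp (row x) (row y)
    ... | tri< rx<ry _ _ = rx<ry
    ... | tri≈ _ rx≡ry _ = contradiction (separate rx≡ry cx≡cy) (Fin.<⇒≢ x<y)
    ... | tri> _ _ ry<rx = contradiction (increasing (sym cx≡cy) ry<rx) (ℕ.<-asym x<y)

  module FromNCT (T : NCT shape) where

    open NCT T

    col : Fin n → Fin columns
    col x = proj₁ (partitions x)

    ∈-col : ∀ {x j} → col x ≡ j → x Subset.∈ part j
    ∈-col refl = proj₁ (proj₂ (partitions _))

    col-∈ : ∀ {x j} → x Subset.∈ part j → col x ≡ j
    col-∈ = proj₂ (proj₂ (partitions _))

    private
      ∈-elements : ∀ x → x ∈ elements (part (col x))
      ∈-elements x = ∈-filter-allFin (Subset._∈? part (col x)) (∈-col refl)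

      length-part : ∀ j → length (elements (part j)) ≡ columnLength j
      length-part j = trans (length-elements (part j)) (sizes j)

      index<rows : ∀ {j} (i : Fin (length (elements (part j)))) → toℕ i < rows
      index<rows {j} i =
        ℕ.<-≤-trans (subst (toℕ i <_) (length-part j) (Fin.toℕ<n i)) (columnLength≤rows j)

    row : Fin n → Fin rows
    row x = fromℕ< (index<rows (Any.index (∈-elements x)))

    -- Freeing `j` from `col x` lets two elements of one part be indexed in literally the same list.
    position : ∀ {x j} → col x ≡ j → Σ (Fin (length (elements (part j)))) λ i →
               toℕ i ≡ toℕ (row x) × lookup (elements (part j)) i ≡ x
    position {x} refl =
        Any.index (∈-elements x)
      , sym (Fin.toℕ-fromℕ< (index<rows (Any.index (∈-elements x))))
      , sym (Any.lookup-index (∈-elements x))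

    private
      elements-increasing : ∀ j → AllPairs Fin._<_ (elements (part j))
      elements-increasing j = filter-increasing (Subset._∈? part j)

      row<columnLength : ∀ {x j} → col x ≡ j → toℕ (row x) < columnLength j
      row<columnLength {x} {j} eq with i , i≡row , _ ← position eq =
        subst (_< columnLength j) i≡row (subst (toℕ i <_) (length-part j) (Fin.toℕ<n i))

      place : ∀ r j → toℕ j < rowLength r → ∃[ x ] (row x ≡ r × col x ≡ j)
      place r j j<row = x , Fin.toℕ-injective (trans (sym (proj₁ (proj₂ pos)))
                                (trans (cong toℕ same) (Fin.toℕ-fromℕ< r<length))) , cx≡j
        where
        r<length : toℕ r < length (elements (part j))
        r<length = subst (toℕ r <_) (sym (length-part j))
          (Equivalence.from (columnLength-rowLength j r) j<row)
        x = lookup (elements (part j)) (fromℕ< r<length)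
        cx≡j : col x ≡ j
        cx≡j = col-∈ (filter-allFin-holds (Subset._∈? part j) (∈.∈-lookup {xs = elements (part j)} _))
        pos = position cx≡j
        same : proj₁ pos ≡ fromℕ< r<length
        same = increasing⇒injective (lookup-increasing _ (elements-increasing j)) (proj₂ (proj₂ pos))

      separate : ∀ {x y} → row x ≡ row y → col x ≡ col y → x ≡ y
      separate {x} {y} rx≡ry cx≡cy =
        let i , i≡ , xᵢ≡x = position cx≡cy
            j , j≡ , xⱼ≡y = position {y} refl
        in trans (sym xᵢ≡x)
             (trans (lookup-≡ {xs = elements (part (col y))} refl
                      (trans i≡ (trans (cong toℕ rx≡ry) (sym j≡)))) xⱼ≡y)

      increasing : ∀ {x y} → col x ≡ col y → row x Fin.< row y → x Fin.< y
      increasing {x} {y} cx≡cy rx<ry =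
        let i , i≡ , xᵢ≡x = position cx≡cy
            j , j≡ , xⱼ≡y = position {y} refl
        in subst₂ Fin._<_ xᵢ≡x xⱼ≡y
             (lookup-increasing (elements (part (col y))) (elements-increasing (col y))
               (subst₂ _<_ (sym i≡) (sym j≡) rx<ry))

      -- If the part of `z` reaches the row of `y`, condition (1) forbids its element there from
      -- lying after `y`; if it does not, `x < z < y` contradicts condition (2). `NonCrossing`
      -- expects the larger part first, hence the split on sizes; when the part of `z` is the larger
      -- one, its next element exists for reasons of size.
      cover : ∀ {x y z} → col x ≡ col y → toℕ (row y) ≡ suc (toℕ (row x)) →
              row z ≡ row x → x Fin.< z → z Fin.< y →
              ∃[ w ] (col w ≡ col z × row w ≡ row y × w Fin.< y)
      cover {x} {y} {z} cx≡cy ry≡ rz≡rx x<z z<y = go (ℕ.≤-total _ _)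
        where
        J = col y
        J′ = col z
        J≢J′ : J ≢ J′
        J≢J′ J≡J′ = Fin.<⇒≢ x<z (separate (sym rz≡rx) (trans cx≡cy J≡J′))

        next : toℕ (row y) < columnLength J′ → ∃[ w ] (row w ≡ row y × col w ≡ J′)
        next ry<h = place (row y) J′ (Equivalence.to (columnLength-rowLength J′ (row y)) ry<h)

        finish : ∀ {w} → row w ≡ row y × col w ≡ J′ → ¬ (y Fin.< w) →
                 ∃[ w ] (col w ≡ col z × row w ≡ row y × w Fin.< y)
        finish {w} (rw≡ry , cw≡J′) y≮w = w , cw≡J′ , rw≡ry ,
          ℕ.≤∧≢⇒< (ℕ.≮⇒≥ y≮w) λ w≡y → J≢J′ (trans (cong col (sym (Fin.toℕ-injective w≡y))) cw≡J′)

        i  = position cx≡cy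
        i′ = position {y} refl
        j  = position {z} refl

        i≡j : toℕ (proj₁ i) ≡ toℕ (proj₁ j)
        i≡j = trans (proj₁ (proj₂ i)) (trans (cong toℕ (sym rz≡rx)) (sym (proj₁ (proj₂ j))))

        i′≡1+i : toℕ (proj₁ i′) ≡ suc (toℕ (proj₁ i))
        i′≡1+i = trans (proj₁ (proj₂ i′)) (trans ry≡ (cong suc (sym (proj₁ (proj₂ i)))))

        aᵢ<bⱼ : lookup (elements (part J)) (proj₁ i) Fin.< lookup (elements (part J′)) (proj₁ j)
        aᵢ<bⱼ = subst₂ Fin._<_ (sym (proj₂ (proj₂ i))) (sym (proj₂ (proj₂ j))) x<z

        bⱼ<aᵢ′ : lookup (elements (part J′)) (proj₁ j) Fin.< lookup (elements (part J)) (proj₁ i′)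
        bⱼ<aᵢ′ = subst₂ Fin._<_ (sym (proj₂ (proj₂ j))) (sym (proj₂ (proj₂ i′))) z<y

        module _ {w} (rw≡ry : row w ≡ row y) (cw≡J′ : col w ≡ J′) where

          j′ = position cw≡J′

          j′≡1+j : toℕ (proj₁ j′) ≡ suc (toℕ (proj₁ j))
          j′≡1+j = trans (proj₁ (proj₂ j′)) (trans (cong toℕ rw≡ry)
            (trans (sym (proj₁ (proj₂ i′))) (trans i′≡1+i (cong suc i≡j))))

          aᵢ′<bⱼ′ : y Fin.< w →
                    lookup (elements (part J)) (proj₁ i′) Fin.< lookup (elements (part J′)) (proj₁ j′)
          aᵢ′<bⱼ′ = subst₂ Fin._<_ (sym (proj₂ (proj₂ i′))) (sym (proj₂ (proj₂ j′)))

        go : ∣ part J′ ∣ ≤ ∣ part J ∣ ⊎ ∣ part J ∣ ≤ ∣ part J′ ∣ →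
             ∃[ w ] (col w ≡ col z × row w ≡ row y × w Fin.< y)
        go (inj₁ J′≤J) with toℕ (row y) ℕ.<? columnLength J′
        ... | yes ry<h =
          let w , rw≡ry , cw≡J′ = next ry<h in
          finish (rw≡ry , cw≡J′) λ y<w →
            proj₁ (noInterleaving i≡j i′≡1+i (j′≡1+j rw≡ry cw≡J′))
              (aᵢ<bⱼ , bⱼ<aᵢ′ , aᵢ′<bⱼ′ rw≡ry cw≡J′ y<w)
          where open NonCrossingSequences (nonCrossing J≢J′ J′≤J)
        ... | no ry≮h = contradiction (aᵢ<bⱼ , bⱼ<aᵢ′)
          (noFinalInterleaving (subst (_< length (elements (part J))) i′≡q (Fin.toℕ<n (proj₁ i′)))
            i≡j (trans (cong suc (sym i≡j)) (trans (sym i′≡1+i) i′≡q)) i′≡q)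
          where
          open NonCrossingSequences (nonCrossing J≢J′ J′≤J)
          -- Here `z` is the last element of its part, so the size of that part is exactly the
          -- 0-based row of `y`.
          i′≡q : toℕ (proj₁ i′) ≡ length (elements (part J′))
          i′≡q = ℕ.≤-antisym
            (subst (_≤ length (elements (part J′))) (trans (cong suc (sym i≡j)) (sym i′≡1+i))
              (Fin.toℕ<n (proj₁ j)))
            (subst₂ _≤_ (sym (length-part J′)) (sym (proj₁ (proj₂ i′))) (ℕ.≮⇒≥ ry≮h))
        go (inj₂ J≤J′) =
          let w , rw≡ry , cw≡J′ = next (ℕ.<-≤-trans (row<columnLength refl)
                (subst₂ _≤_ (sizes J) (sizes J′) J≤J′))
          in finish (rw≡ry , cw≡J′) λ y<w →
            proj₂ (noInterleaving (sym i≡j) (j′≡1+j rw≡ry cw≡J′) i′≡1+i)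
              (aᵢ<bⱼ , bⱼ<aᵢ′ , aᵢ′<bⱼ′ rw≡ry cw≡J′ y<w)
          where open NonCrossingSequences (nonCrossing (J≢J′ ∘ sym) J≤J′)

    layout : Layout
    layout = record
      { row = row ; col = col
      ; fits = λ x → Equivalence.to (columnLength-rowLength (col x) (row x)) (row<columnLength refl)
      ; place = place ; separate = separate ; increasing = increasing ; cover = cover }

-- The non-crossing tableau of a layout

module FromLayout {n : ℕ} {shape : Partition n} (L : Shape.Layout shape) where

  open Shape shape
  open Layout L

  part : Fin columns → Subset n
  part j = comprehension (λ x → col x Fin.≟ j)

  ∈-part⁺ : ∀ {x j} → col x ≡ j → x Subset.∈ part j
  ∈-part⁺ {j = j} = ∈-comprehension⁺ (λ x → col x Fin.≟ j)

  ∈-part⁻ : ∀ {x j} → x Subset.∈ part j → col x ≡ j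
  ∈-part⁻ {j = j} = ∈-comprehension⁻ (λ x → col x Fin.≟ j)

  private
    module _ (j : Fin columns) where

      rowAt : Fin (columnLength j) → Fin rows
      rowAt i = Fin.inject≤ i (columnLength≤rows j)

      placed : ∀ i → ∃[ x ] (row x ≡ rowAt i × col x ≡ j)
      placed i = place (rowAt i) j (Equivalence.to (columnLength-rowLength j (rowAt i))
        (ℕ.≤-<-trans (ℕ.≤-reflexive (Fin.toℕ-inject≤ i (columnLength≤rows j))) (Fin.toℕ<n i)))

      element : Fin (columnLength j) → Fin n
      element i = proj₁ (placed i)

      col-element : ∀ i → col (element i) ≡ j
      col-element i = proj₂ (proj₂ (placed i))

      row-element : ∀ i → toℕ (row (element i)) ≡ toℕ i
      row-element i = trans (cong toℕ (proj₁ (proj₂ (placed i)))) (Fin.toℕ-inject≤ i (columnLength≤rows j))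

      row<columnLength : ∀ {x} → col x ≡ j → toℕ (row x) < columnLength j
      row<columnLength {x} refl = Equivalence.from (columnLength-rowLength j (row x)) (fits x)

      element-row : ∀ {x} → col x ≡ j → ∃[ i ] element i ≡ x
      element-row {x} cx≡j = fromℕ< (row<columnLength cx≡j) , separate
        (Fin.toℕ-injective (trans (row-element _) (Fin.toℕ-fromℕ< (row<columnLength cx≡j))))
        (trans (col-element _) (sym cx≡j))

      elements-part : elements (part j) ≡ tabulate element
      elements-part = filter-enumeration (Subset._∈? part j) element
        (λ {i} {i′} i<i′ → increasing (trans (col-element i) (sym (col-element i′)))
                             (subst₂ _<_ (sym (row-element i)) (sym (row-element i′)) i<i′))
        (∈-part⁺ ∘ col-element) (element-row ∘ ∈-part⁻)

    length-part : ∀ j → length (elements (part j)) ≡ columnLength j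
    length-part j = trans (cong length (elements-part j)) (List.length-tabulate (element j))

    Index : Fin columns → Set
    Index j = Fin (length (elements (part j)))

    nth : ∀ j → Index j → Fin n
    nth j = lookup (elements (part j))

    col-nth : ∀ {j} i → col (nth j i) ≡ j
    col-nth {j} i = ∈-part⁻ (filter-allFin-holds (Subset._∈? part j)
      (∈.∈-lookup {xs = elements (part j)} i))

    row-nth : ∀ {j} i → toℕ (row (nth j i)) ≡ toℕ i
    row-nth {j} i = begin
      toℕ (row (nth j i))
        ≡⟨ cong (toℕ ∘ row) (lookup-≡ (elements-part j)
             (sym (Fin.toℕ-cast (cong length (elements-part j)) i))) ⟩
      toℕ (row (lookup (tabulate (element j)) (cast _ i)))
        ≡⟨ cong (toℕ ∘ row) (lookup-tabulate′ (element j)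
             (trans (Fin.toℕ-cast (cong length (elements-part j)) i)
                    (sym (Fin.toℕ-cast (length-part j) i)))) ⟩
      toℕ (row (element j (cast (length-part j) i)))
        ≡⟨ row-element j _ ⟩
      toℕ (cast (length-part j) i)
        ≡⟨ Fin.toℕ-cast (length-part j) i ⟩
      toℕ i ∎
      where open ≡-Reasoning

    covered : ∀ {j j′} {i i′ : Index j} {k : Index j′} →
              toℕ i′ ≡ suc (toℕ i) → toℕ i ≡ toℕ k →
              nth j i Fin.< nth j′ k → nth j′ k Fin.< nth j i′ →
              ∃[ w ] (col w ≡ j′ × toℕ (row w) ≡ toℕ i′ × w Fin.< nth j i′)
    covered {i = i} {i′} {k} i′≡1+i i≡k xᵢ<xₖ xₖ<xᵢ′ =
      let w , cw≡ , rw≡ , w< = cover (trans (col-nth i) (sym (col-nth i′)))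
            (trans (row-nth i′) (trans i′≡1+i (cong suc (sym (row-nth i)))))
            (Fin.toℕ-injective (trans (row-nth k) (trans (sym i≡k) (sym (row-nth i)))))
            xᵢ<xₖ xₖ<xᵢ′
      in w , trans cw≡ (col-nth k) , trans (cong toℕ rw≡) (row-nth i′) , w<

    -- The element supplied by `cover` has the row and column of the one at `k′`, so it is that
    -- element, and it comes before the one at `i′`.
    not-interleaved : ∀ {j j′} {i i′ : Index j} {k k′ : Index j′} →
                      toℕ i ≡ toℕ k → toℕ i′ ≡ suc (toℕ i) → toℕ k′ ≡ suc (toℕ k) →
                      ¬ (nth j i Fin.< nth j′ k × nth j′ k Fin.< nth j i′ × nth j i′ Fin.< nth j′ k′)
    not-interleaved {j = j} {i = i} {i′} {k} {k′} i≡k i′≡1+i k′≡1+k (xᵢ<xₖ , xₖ<xᵢ′ , xᵢ′<xₖ′) =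
      let w , cw≡ , rw≡ , w< = covered i′≡1+i i≡k xᵢ<xₖ xₖ<xᵢ′
          w≡xₖ′ = separate (Fin.toℕ-injective (trans rw≡ (trans i′≡1+i (trans (cong suc i≡k)
                    (trans (sym k′≡1+k) (sym (row-nth k′))))))) (trans cw≡ (sym (col-nth k′)))
      in ℕ.<-asym xᵢ′<xₖ′ (subst (Fin._< nth j i′) w≡xₖ′ w<)

  nct : NCT shape
  nct = record
    { part        = part
    ; partitions  = λ x → col x , ∈-part⁺ refl , ∈-part⁻
    ; sizes       = λ j → trans (sym (length-elements (part j))) (length-part j)
    ; nonCrossing = λ {j} {j′} _ _ → record
      { noInterleaving = λ i≡k i′≡1+i k′≡1+k →
          not-interleaved i≡k i′≡1+i k′≡1+k , not-interleaved (sym i≡k) k′≡1+k i′≡1+i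
      -- `cover` would place an element of part `j′` in row q, but that part has q elements, in rows
      -- 0 to q - 1.
      ; noFinalInterleaving = λ q<p {i} {i′} {k} i≡k 1+k≡q i′≡q (xᵢ<xₖ , xₖ<xᵢ′) →
          let w , cw≡ , rw≡ , _ = covered (trans i′≡q (trans (sym 1+k≡q) (cong suc (sym i≡k))))
                                          i≡k xᵢ<xₖ xₖ<xᵢ′
          in ℕ.<-irrefl (trans rw≡ i′≡q)
               (subst (toℕ (row w) <_) (sym (length-part j′)) (row<columnLength j′ cw≡))
      }
    }

  col-nct : ∀ x → FromNCT.col nct x ≡ col x
  col-nct x = FromNCT.col-∈ nct (∈-part⁺ refl)

  -- The round trip through subsets must return the original rows, so that the tableau read off from
  -- `nct` can be computed in the layout.
  row-nct : ∀ x → FromNCT.row nct x ≡ row x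
  row-nct x = let i , i≡ , xᵢ≡x = FromNCT.position nct (col-nct x) in
    Fin.toℕ-injective (trans (sym i≡) (trans (sym (row-nth i)) (cong (toℕ ∘ row) xᵢ≡x)))

-- Rows of a layout

Cell : List ℕ → Set
Cell ps = Σ (Fin (length ps)) (Fin ∘ lookup ps)

-- Through `reading-word`, the nested list of entries becomes one tabulation over `Fin n`, to which
-- permutation arguments apply.
record CellNumbering (ps : List ℕ) (n : ℕ) : Set where
  field
    number        : Cell ps → Fin n
    cellAt        : Fin n → Cell ps
    cellAt-number : ∀ c → cellAt (number c) ≡ c
    number-cellAt : ∀ x → number (cellAt x) ≡ x
    number-<      : ∀ r {c c′} → c Fin.< c′ → number (r , c) Fin.< number (r , c′)
    reading-word  : ∀ {k} (e : ∀ r → Fin (lookup ps r) → Fin k) →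
                    concat (tabulate λ r → tabulate (e r)) ≡
                    tabulate (λ x → e (proj₁ (cellAt x)) (proj₂ (cellAt x)))

tabulate-splitAt : ∀ {A : Set} m {n} (f : Fin (m + n) → A) →
                   tabulate f ≡ tabulate (f ∘ (_↑ˡ n)) ++ tabulate (f ∘ (m ↑ʳ_))
tabulate-splitAt zero    f = refl
tabulate-splitAt (suc m) f = cong (f zero ∷_) (tabulate-splitAt m (f ∘ suc))

cellNumbering : ∀ ps {n} → sum ps ≡ n → CellNumbering ps n
cellNumbering [] refl = record
  { number        = λ ()
  ; cellAt        = λ ()
  ; cellAt-number = λ ()
  ; number-cellAt = λ ()
  ; number-<      = λ ()
  ; reading-word  = λ _ → refl
  }
cellNumbering (p ∷ ps) refl = record
  { number        = number
  ; cellAt        = cellAt ∘ Fin.splitAt p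
  ; cellAt-number = cellAt-number
  ; number-cellAt = number-cellAt
  ; number-<      = number-<
  ; reading-word  = reading-word
  }
  where
  module Rest = CellNumbering (cellNumbering ps refl)

  number : Cell (p ∷ ps) → Fin (p + sum ps)
  number (zero  , c) = c ↑ˡ sum ps
  number (suc r , c) = p ↑ʳ Rest.number (r , c)

  cellAt : Fin p ⊎ Fin (sum ps) → Cell (p ∷ ps)
  cellAt (inj₁ c) = zero , c
  cellAt (inj₂ x) = suc (proj₁ (Rest.cellAt x)) , proj₂ (Rest.cellAt x)

  cellAt-number : ∀ c → cellAt (Fin.splitAt p (number c)) ≡ c
  cellAt-number (zero  , c) = cong cellAt (Fin.splitAt-↑ˡ p c (sum ps))
  cellAt-number (suc r , c) = trans
    (cong cellAt (Fin.splitAt-↑ʳ p (sum ps) (Rest.number (r , c))))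
    (cong (λ (r , c) → suc r , c) (Rest.cellAt-number (r , c)))

  number-cellAt : ∀ x → number (cellAt (Fin.splitAt p x)) ≡ x
  number-cellAt x with Fin.splitAt p x in eq
  ... | inj₁ c = Fin.splitAt⁻¹-↑ˡ eq
  ... | inj₂ y = trans (cong (p ↑ʳ_) (Rest.number-cellAt y)) (Fin.splitAt⁻¹-↑ʳ eq)

  number-< : ∀ r {c c′} → c Fin.< c′ → number (r , c) Fin.< number (r , c′)
  number-< zero {c} {c′} c<c′ =
    subst₂ _<_ (sym (Fin.toℕ-↑ˡ c (sum ps))) (sym (Fin.toℕ-↑ˡ c′ (sum ps))) c<c′
  number-< (suc r) {c} {c′} c<c′ =
    subst₂ _<_ (sym (Fin.toℕ-↑ʳ p _)) (sym (Fin.toℕ-↑ʳ p _)) (ℕ.+-monoʳ-< p (Rest.number-< r c<c′))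

  reading-word : ∀ {k} (e : ∀ r → Fin (lookup (p ∷ ps) r) → Fin k) →
                 concat (tabulate λ r → tabulate (e r)) ≡
                 tabulate (λ x → let r , c = cellAt (Fin.splitAt p x) in e r c)
  reading-word e = sym (trans (tabulate-splitAt p f) (cong₂ _++_
    (List.tabulate-cong λ c → cong entry (Fin.splitAt-↑ˡ p c (sum ps)))
    (trans (List.tabulate-cong λ x → cong entry (Fin.splitAt-↑ʳ p (sum ps) x))
           (sym (Rest.reading-word (λ r → e (suc r)))))))
    where
    entry : Fin p ⊎ Fin (sum ps) → Fin _
    entry s = let r , c = cellAt s in e r c
    f = entry ∘ Fin.splitAt p

module Rows {n : ℕ} {shape : Partition n} (L : Shape.Layout shape) where

  open Shape shape
  open Layout L

  private
    rowList : Fin rows → List (Fin n)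
    rowList r = filter (λ x → row x Fin.≟ r) (allFin n)

    -- By `fits`, `place` and `separate`, the columns identify row `r` with the column indices below
    -- `rowLength r`.
    length-rowList : ∀ r → length (rowList r) ≡ rowLength r
    length-rowList r = trans
      (↭.↭-length (unique-↭ (Unique.filter⁺ _ (Unique.allFin⁺ n)) (Unique.tabulate⁺ element-injective)
        (λ {x} x∈ → ∈-elements (filter-allFin-holds (λ x → row x Fin.≟ r) x∈))
        (λ x∈ → let c , x≡ = ∈.∈-tabulate⁻ x∈ in
                ∈-filter-allFin (λ x → row x Fin.≟ r)
                  (trans (cong row x≡) (proj₁ (proj₂ (placed c)))))))
      (List.length-tabulate element)
      where
      column : Fin (rowLength r) → Fin columns
      column c = Fin.inject≤ c (rowLength≤columns r)

      placed : ∀ c → ∃[ x ] (row x ≡ r × col x ≡ column c)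
      placed c = place r (column c)
        (subst (_< rowLength r) (sym (Fin.toℕ-inject≤ c (rowLength≤columns r))) (Fin.toℕ<n c))

      element : Fin (rowLength r) → Fin n
      element c = proj₁ (placed c)

      element-injective : ∀ {c c′} → element c ≡ element c′ → c ≡ c′
      element-injective {c} {c′} eq = Fin.inject≤-injective (rowLength≤columns r) (rowLength≤columns r) c c′
        (trans (sym (proj₂ (proj₂ (placed c)))) (trans (cong col eq) (proj₂ (proj₂ (placed c′)))))

      ∈-elements : ∀ {x} → row x ≡ r → x ∈ tabulate element
      ∈-elements {x} refl = subst (_∈ tabulate element)
        (separate (proj₁ (proj₂ (placed c)))
          (trans (proj₂ (proj₂ (placed c))) (Fin.toℕ-injective
            (trans (Fin.toℕ-inject≤ c (rowLength≤columns r)) (Fin.toℕ-fromℕ< (fits x))))))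
        (∈.∈-tabulate⁺ c)
        where c = fromℕ< (fits x)

  rowSort : ∀ r → Fin (rowLength r) → Fin n
  rowSort r c = lookup (rowList r) (cast (sym (length-rowList r)) c)

  row-rowSort : ∀ r c → row (rowSort r c) ≡ r
  row-rowSort r c = filter-allFin-holds (λ x → row x Fin.≟ r) (∈.∈-lookup {xs = rowList r} _)

  rowSort-< : ∀ r {c c′} → c Fin.< c′ → rowSort r c Fin.< rowSort r c′
  rowSort-< r {c} {c′} c<c′ = lookup-increasing (rowList r) (filter-increasing (λ x → row x Fin.≟ r))
    (subst₂ _<_ (sym (Fin.toℕ-cast _ c)) (sym (Fin.toℕ-cast _ c′)) c<c′)

  rowSort-≤ : ∀ r {c c′} → c Fin.≤ c′ → rowSort r c Fin.≤ rowSort r c′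
  rowSort-≤ r {c} {c′} c≤c′ with Fin.<-cmp c c′
  ... | tri< c<c′ _ _ = ℕ.<⇒≤ (rowSort-< r c<c′)
  ... | tri≈ _ refl _ = ℕ.≤-refl
  ... | tri> _ _ c′<c = contradiction c≤c′ (ℕ.<⇒≱ c′<c)

  rowSort-surjective : ∀ {r x} → row x ≡ r → ∃[ c ] rowSort r c ≡ x
  rowSort-surjective {r} {x} rx≡r = cast (length-rowList r) (Any.index x∈) ,
    trans (lookup-≡ {xs = rowList r} refl (trans (Fin.toℕ-cast _ (cast (length-rowList r) (Any.index x∈)))
             (Fin.toℕ-cast _ (Any.index x∈))))
      (sym (Any.lookup-index x∈))
    where
    x∈ : x ∈ rowList r
    x∈ = ∈-filter-allFin (λ x → row x Fin.≟ r) rx≡r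

  -- Lets a sorted row be recognised from any increasing enumeration of it, in particular one that
  -- comes from a given tableau.
  rowSort-unique : ∀ r (f : Fin (rowLength r) → Fin n) → (∀ {c c′} → c Fin.< c′ → f c Fin.< f c′) →
                   (∀ c → row (f c) ≡ r) → (∀ {x} → row x ≡ r → ∃[ c ] f c ≡ x) →
                   ∀ c → rowSort r c ≡ f c
  rowSort-unique r f f-mono row-f f-surj c = trans
    (lookup-≡ rowList≡ (sym (Fin.toℕ-cast (cong length rowList≡) (cast (sym (length-rowList r)) c))))
    (lookup-tabulate′ f (trans (Fin.toℕ-cast (cong length rowList≡) _) (Fin.toℕ-cast _ c)))
    where
    rowList≡ : rowList r ≡ tabulate f
    rowList≡ = filter-enumeration (λ x → row x Fin.≟ r) f f-mono row-f f-surj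

  rowSort-injective : ∀ {s t : Cell parts} →
                      rowSort (proj₁ s) (proj₂ s) ≡ rowSort (proj₁ t) (proj₂ t) → s ≡ t
  rowSort-injective {r , c} {r′ , c′} eq
    with refl ← trans (sym (row-rowSort r c)) (trans (cong row eq) (row-rowSort r′ c′))
    = cong (r ,_) (increasing⇒injective (rowSort-< r) eq)

module RowSorted {n : ℕ} {shape : Partition n} (μ : List ℕ) (sum-μ : sum μ ≡ n)
                 (L : Shape.Layout shape) where

  open Shape shape
  open Layout L
  open Rows L
  open Segments μ sum-μ

  module _ (segment-< : ∀ {x y} → col x ≡ col y → row x Fin.< row y → segment x Fin.< segment y) where

    private
      entry : ∀ r → Fin (rowLength r) → Fin (length μ)
      entry r c = segment (rowSort r c)

      -- If the entry in row r were not smaller, then the parts of the first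
      -- c + 1 elements of row r′ would all meet row r in its first c elements.
      columnsStrict : ∀ {r r′} → r Fin.< r′ → (c : Fin (rowLength r)) (c′ : Fin (rowLength r′)) →
                      toℕ c ≡ toℕ c′ → entry r c Fin.< entry r′ c′
      columnsStrict {r} {r′} r<r′ c c′ c≡c′ = ℕ.≰⇒> λ e′≤e →
        let i , j , i<j , fᵢ≡fⱼ = Fin.pigeonhole (s≤s (ℕ.≤-reflexive c≡c′)) (f e′≤e)
        in Fin.<⇒≢ i<j (f-injective e′≤e fᵢ≡fⱼ)
        where
        at : Fin (suc (toℕ c′)) → Fin (rowLength r′)
        at t = Fin.inject≤ t (Fin.toℕ<n c′)

        at≤c′ : ∀ t → at t Fin.≤ c′
        at≤c′ t = ℕ.≤-trans (ℕ.≤-reflexive (Fin.toℕ-inject≤ t (Fin.toℕ<n c′))) (ℕ.s≤s⁻¹ (Fin.toℕ<n t))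

        x : Fin (suc (toℕ c′)) → Fin n
        x t = rowSort r′ (at t)

        row-x : ∀ t → row (x t) ≡ r′
        row-x t = row-rowSort r′ (at t)

        y : ∀ t → ∃[ y ] (row y ≡ r × col y ≡ col (x t))
        y t = above (x t) (subst (r Fin.≤_) (sym (row-x t)) (ℕ.<⇒≤ r<r′))

        d : ∀ t → ∃[ d ] rowSort r d ≡ proj₁ (y t)
        d t = rowSort-surjective (proj₁ (proj₂ (y t)))

        module _ (e′≤e : entry r′ c′ Fin.≤ entry r c) where

          d<c : ∀ t → proj₁ (d t) Fin.< c
          d<c t = increasing-reflects (rowSort-< r) (segment-reflects-< (ℕ.<-≤-trans
            (subst (λ z → segment z Fin.< segment (x t)) (sym (proj₂ (d t)))
              (segment-< (proj₂ (proj₂ (y t)))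
                (subst₂ Fin._<_ (sym (proj₁ (proj₂ (y t)))) (sym (row-x t)) r<r′)))
            (ℕ.≤-trans (segment-mono (rowSort-≤ r′ (at≤c′ t))) e′≤e)))

          f : Fin (suc (toℕ c′)) → Fin (toℕ c)
          f t = fromℕ< (d<c t)

          f-injective : ∀ {t u} → f t ≡ f u → t ≡ u
          f-injective {t} {u} ft≡fu = Fin.inject≤-injective (Fin.toℕ<n c′) (Fin.toℕ<n c′) t u
            (increasing⇒injective (rowSort-< r′) (separate (trans (row-x t) (sym (row-x u)))
              (trans (sym (proj₂ (proj₂ (y t)))) (trans (cong col y≡) (proj₂ (proj₂ (y u)))))))
            where
            d≡ : proj₁ (d t) ≡ proj₁ (d u)
            d≡ = Fin.toℕ-injective (Fin.fromℕ<-injective _ _ (d<c t) (d<c u) ft≡fu)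
            y≡ : proj₁ (y t) ≡ proj₁ (y u)
            y≡ = trans (sym (proj₂ (d t))) (trans (cong (rowSort r) d≡) (proj₂ (d u)))

      open CellNumbering (cellNumbering parts total)

      -- The sorted rows read one after another. They list every element exactly once, so the
      -- tableau has the weight of the segments.
      π : Fin n → Fin n
      π x = rowSort (proj₁ (cellAt x)) (proj₂ (cellAt x))

      π-injective : Injective _≡_ _≡_ π
      π-injective {x} {y} eq =
        trans (sym (number-cellAt x)) (trans (cong number (rowSort-injective eq)) (number-cellAt y))

    tableau : SSYT shape μ
    tableau = record
      { entry                   = entry
      ; rowsWeaklyIncrease      = λ r → segment-mono ∘ rowSort-≤ r
      ; columnsStrictlyIncrease = columnsStrict
      ; weight                  = λ i → begin
          count i (concat (tabulate λ r → tabulate (entry r)))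
            ≡⟨ cong (count i) (reading-word entry) ⟩
          count i (tabulate (segment ∘ π))
            ≡⟨ cong (count i) (List.map-tabulate π segment) ⟨
          count i (map segment (tabulate π))
            ≡⟨ count-↭ (↭.map⁺ segment (tabulate-↭ π-injective)) i ⟩
          count i (map segment (allFin n))
            ≡⟨ cong (count i) (List.map-tabulate id segment) ⟩
          count i (tabulate segment)
            ≡⟨ count-segment i ⟩
          lookup μ i ∎
      }
      where open ≡-Reasoning

-- Uniqueness of the layout with given row contents

tabulate-injective : ∀ {A : Set} {f g : Fin n → A} → tabulate f ≡ tabulate g → ∀ i → f i ≡ g i
tabulate-injective {f = f} {g} eq i = begin
  f i
    ≡⟨ lookup-tabulate′ f (Fin.toℕ-cast _ i) ⟨
  lookup (tabulate f) (cast (sym (List.length-tabulate f)) i)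
    ≡⟨ lookup-≡ eq (trans (Fin.toℕ-cast _ i) (sym (Fin.toℕ-cast _ i))) ⟩
  lookup (tabulate g) (cast (sym (List.length-tabulate g)) i)
    ≡⟨ lookup-tabulate′ g (Fin.toℕ-cast _ i) ⟩
  g i ∎
  where open ≡-Reasoning

module _ {n : ℕ} {shape : Partition n} where

  open Shape shape

  module _ (L : Layout) where
    open Layout L

    Near : Fin n → Fin n → Set
    Near x y = row x ≡ row y ⊎ toℕ (row y) ≡ suc (toℕ (row x))

  -- What bracket matching can see: the order inside a row and between adjacent rows. `Near` only
  -- has pairs whose second element is in the same row or the next one; the opposite order across
  -- rows is preserved too, by `from-<`.
  record RowIso (L L′ : Layout) : Set where
    private module L = Layout L
    private module L′ = Layout L′
    field
      to      : Fin n → Fin n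
      from    : Fin n → Fin n
      to-from : ∀ x → to (from x) ≡ x
      from-to : ∀ x → from (to x) ≡ x
      row-to  : ∀ x → L′.row (to x) ≡ L.row x
      to-<    : ∀ {x y} → Near L x y → x Fin.< y → to x Fin.< to y
      from-<  : ∀ {x y} → Near L′ x y → x Fin.< y → from x Fin.< from y

    to-injective : ∀ {x y} → to x ≡ to y → x ≡ y
    to-injective {x} {y} eq = trans (sym (from-to x)) (trans (cong from eq) (from-to y))

    row-from : ∀ x → L.row (from x) ≡ L′.row x
    row-from x = trans (sym (row-to (from x))) (cong L′.row (to-from x))

  RowIso-sym : ∀ {L L′} → RowIso L L′ → RowIso L′ L
  RowIso-sym I = record
    { to = from ; from = to ; to-from = from-to ; from-to = to-from
    ; row-to = row-from ; to-< = from-< ; from-< = to-< }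
    where open RowIso I

  module _ {L L′ : Layout} (I : RowIso L L′) where
    private module L = Layout L
    private module L′ = Layout L′
    open RowIso I

    private
      ColumnsAgree : Fin n → Set
      ColumnsAgree y = ∀ x → L.col x ≡ L.col y → toℕ (L.row y) ≡ suc (toℕ (L.row x)) →
                       L′.col (to x) ≡ L′.col (to y)

      -- Let p precede to y in its part. If p ≠ to x, then the larger of the two lies
      -- under the arc from the smaller one to y, so its own arc closes before y. By
      -- induction it has the same arc on the other side, where it is joined to y.
      agree-step : ∀ y → (∀ {w} → w Fin.< y → ColumnsAgree w) → ColumnsAgree y
      agree-step y ih x cx≡cy ry≡ = go (L′.above (to y) rx≤ry′)
        where
        rx≤ry′ : L.row x Fin.≤ L′.row (to y)
        rx≤ry′ = subst (λ r → L.row x Fin.≤ r) (sym (row-to y))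
          (ℕ.≤-trans (ℕ.n≤1+n _) (ℕ.≤-reflexive (sym ry≡)))

        go : ∃[ p ] (L′.row p ≡ L.row x × L′.col p ≡ L′.col (to y)) → L′.col (to x) ≡ L′.col (to y)
        go (p , rp≡ , cp≡) with Fin.<-cmp (to x) p
        ... | tri≈ _ refl _ = cp≡
        ... | tri< tox<p _ _ = contradiction w≡y (Fin.<⇒≢ w<y)
          where
          z = from p
          rz≡ : L.row z ≡ L.row x
          rz≡ = trans (row-from p) rp≡
          p<toy : p Fin.< to y
          p<toy = L′.increasing cp≡ (subst₂ Fin._<_ (sym rp≡) (sym (row-to y)) (ℕ.≤-reflexive (sym ry≡)))
          x<z : x Fin.< z
          x<z = subst (Fin._< z) (from-to x) (from-< (inj₁ (trans (row-to x) (sym rp≡))) tox<p)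
          z<y : z Fin.< y
          z<y = subst (z Fin.<_) (from-to y)
            (from-< (inj₂ (trans (cong toℕ (row-to y)) (trans ry≡ (cong (suc ∘ toℕ) (sym rp≡))))) p<toy)
          covered = L.cover cx≡cy ry≡ rz≡ x<z z<y
          w = proj₁ covered
          w<y : w Fin.< y
          w<y = proj₂ (proj₂ (proj₂ covered))
          rw≡ : L.row w ≡ L.row y
          rw≡ = proj₁ (proj₂ (proj₂ covered))
          w≡y : w ≡ y
          w≡y = to-injective (L′.separate (trans (row-to w) (trans rw≡ (sym (row-to y))))
            (trans (sym (ih w<y z (sym (proj₁ (proj₂ covered)))
                          (trans (cong toℕ rw≡) (trans ry≡ (cong (suc ∘ toℕ) (sym rz≡))))))
                   (trans (cong L′.col (to-from p)) cp≡)))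
        ... | tri> _ _ p<tox = contradiction w≡y (Fin.<⇒≢ w<y)
          where
          x<y : x Fin.< y
          x<y = L.increasing cx≡cy (ℕ.≤-reflexive (sym ry≡))
          covered = L′.cover cp≡ (trans (cong toℕ (row-to y)) (trans ry≡ (cong (suc ∘ toℕ) (sym rp≡))))
            (trans (row-to x) (sym rp≡)) p<tox (to-< (inj₂ ry≡) x<y)
          w′ = proj₁ covered
          w = from w′
          rw′≡ : L′.row w′ ≡ L′.row (to y)
          rw′≡ = proj₁ (proj₂ (proj₂ covered))
          rw≡ : L.row w ≡ L.row y
          rw≡ = trans (row-from w′) (trans rw′≡ (row-to y))
          w<y : w Fin.< y
          w<y = subst (w Fin.<_) (from-to y) (from-< (inj₁ rw′≡) (proj₂ (proj₂ (proj₂ covered))))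
          upper = L.above {L.row x} w
            (subst (L.row x Fin.≤_) (sym rw≡) (ℕ.≤-trans (ℕ.n≤1+n _) (ℕ.≤-reflexive (sym ry≡))))
          u = proj₁ upper
          ru≡ : L.row u ≡ L.row x
          ru≡ = proj₁ (proj₂ upper)
          cu≡ : L.col u ≡ L.col w
          cu≡ = proj₂ (proj₂ upper)
          u≡x : u ≡ x
          u≡x = to-injective (L′.separate (trans (row-to u) (trans ru≡ (sym (row-to x))))
            (trans (ih w<y u cu≡ (trans (cong toℕ rw≡) (trans ry≡ (cong (suc ∘ toℕ) (sym ru≡)))))
              (trans (cong L′.col (to-from w′)) (proj₁ (proj₂ covered)))))
          w≡y : w ≡ y
          w≡y = L.separate rw≡ (trans (sym cu≡) (trans (cong L.col u≡x) cx≡cy))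

      adjacent-agree : ∀ y → ColumnsAgree y
      adjacent-agree y = go y (<-wellFounded y)
        where
        go : ∀ y → Acc Fin._<_ y → ColumnsAgree y
        go y (acc rec) = agree-step y (λ w<y → go _ (rec w<y))

      -- Follows the part one row at a time; a part reaching the row of `y` meets all rows above it.
      distance-agree : ∀ d {x y} → L.col x ≡ L.col y → toℕ (L.row y) ≡ d + toℕ (L.row x) →
                       L′.col (to x) ≡ L′.col (to y)
      distance-agree zero cx≡cy ry≡ =
        cong (L′.col ∘ to) (L.separate (Fin.toℕ-injective (sym ry≡)) cx≡cy)
      distance-agree (suc d) {x} {y} cx≡cy ry≡ =
        let z , rz≡ , cz≡ = L.above {fromℕ< r<rows} y
              (ℕ.≤-trans (ℕ.≤-reflexive (Fin.toℕ-fromℕ< r<rows)) (ℕ.<⇒≤ r<ry))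
            rz≡′ = trans (cong toℕ rz≡) (Fin.toℕ-fromℕ< r<rows)
        in trans (distance-agree d (trans cx≡cy (sym cz≡)) rz≡′)
                 (adjacent-agree y z cz≡ (trans ry≡ (cong suc (sym rz≡′))))
        where
        r<ry : d + toℕ (L.row x) < toℕ (L.row y)
        r<ry = ℕ.≤-reflexive (sym ry≡)
        r<rows : d + toℕ (L.row x) < rows
        r<rows = ℕ.<-trans r<ry (Fin.toℕ<n (L.row y))

    columns-agree : ∀ {x y} → L.col x ≡ L.col y → L′.col (to x) ≡ L′.col (to y)
    columns-agree {x} {y} cx≡cy with ℕ.≤-total (toℕ (L.row x)) (toℕ (L.row y))
    ... | inj₁ rx≤ry = distance-agree _ cx≡cy (sym (ℕ.m∸n+n≡m rx≤ry))
    ... | inj₂ ry≤rx = sym (distance-agree _ (sym cx≡cy) (sym (ℕ.m∸n+n≡m ry≤rx)))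

  -- Layouts whose parts increase strictly through the segments

  module _ (μ : List ℕ) (sum-μ : sum μ ≡ n) where

    open Segments μ sum-μ

    SegmentIncreasing : Layout → Set
    SegmentIncreasing L = ∀ {x y} → col x ≡ col y → row x Fin.< row y → segment x Fin.< segment y
      where open Layout L

    -- If x < y lay in one segment, the part of x would have to continue before y.
    segment-<-adjacent : ∀ L → SegmentIncreasing L → let open Layout L in
                         ∀ {x y} → toℕ (row y) ≡ suc (toℕ (row x)) → x Fin.< y → segment x Fin.< segment y
    segment-<-adjacent L segment-< {x} {y} ry≡ x<y = ℕ.≤∧≢⇒< (segment-mono (ℕ.<⇒≤ x<y)) λ sx≡sy →
      let open Layout L
          p , rp≡ , cp≡ = above {row x} y (ℕ.≤-trans (ℕ.n≤1+n _) (ℕ.≤-reflexive (sym ry≡)))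
          rp<ry = subst (Fin._< row y) (sym rp≡) (ℕ.≤-reflexive (sym ry≡))
          p<x = segment-reflects-< (subst (toℕ (segment p) <_) (sym sx≡sy) (segment-< cp≡ rp<ry))
          w , cw≡ , rw≡ , w<y = cover cp≡ (trans ry≡ (cong (suc ∘ toℕ) (sym rp≡))) (sym rp≡) p<x x<y
          sx<sw = segment-< (sym cw≡) (subst (row x Fin.<_) (sym rw≡) (ℕ.≤-reflexive (sym ry≡)))
      in ℕ.<-irrefl sx≡sy (ℕ.<-≤-trans sx<sw (segment-mono (ℕ.<⇒≤ w<y)))

    module _ (L L′ : Layout) (segment-<L : SegmentIncreasing L)
             (same : ∀ r c → segment (Rows.rowSort L r c) ≡ segment (Rows.rowSort L′ r c)) where
      private
        module L = Layout L
        module L′ = Layout L′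
        module R = Rows L
        module R′ = Rows L′

      -- The element at a given place of a sorted row goes to the element at the same place of the
      -- same row of `L′`; by `same`, it stays in its segment.
      transport : Fin n → Fin n
      transport x = R′.rowSort (L.row x) (proj₁ (R.rowSort-surjective refl))

      transport-rowSort : ∀ r c → transport (R.rowSort r c) ≡ R′.rowSort r c
      transport-rowSort r c = cong (λ (r , c) → R′.rowSort r c)
        (R.rowSort-injective (proj₂ (R.rowSort-surjective {x = R.rowSort r c} refl)))

      segment-transport : ∀ x → segment (transport x) ≡ segment x
      segment-transport x = trans (sym (same _ _)) (cong segment (proj₂ (R.rowSort-surjective refl)))

      row-transport : ∀ x → L′.row (transport x) ≡ L.row x
      row-transport x = R′.row-rowSort _ _

      -- Inside a row the order is kept by construction. Across adjacent rows it has to be visible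
      -- in the segments, and it is: there `x < y` forces different segments.
      transport-< : ∀ {x y} → Near L x y → x Fin.< y → transport x Fin.< transport y
      transport-< {x} {y} (inj₁ rx≡ry) x<y =
        subst₂ Fin._<_ (trans (sym (transport-rowSort _ _)) (cong transport c≡))
                       (trans (sym (transport-rowSort _ _)) (cong transport d≡))
          (R′.rowSort-< (L.row x) {proj₁ c} {proj₁ d}
            (increasing-reflects (R.rowSort-< (L.row x)) (subst₂ Fin._<_ (sym c≡) (sym d≡) x<y)))
        where
        c = R.rowSort-surjective {x = x} refl
        d = R.rowSort-surjective {x = y} (sym rx≡ry)
        c≡ = proj₂ c
        d≡ = proj₂ d
      transport-< {x} {y} (inj₂ ry≡) x<y = segment-reflects-<
        (subst₂ Fin._<_ (sym (segment-transport x)) (sym (segment-transport y))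
          (segment-<-adjacent L segment-<L ry≡ x<y))

    rowIso : ∀ L L′ → SegmentIncreasing L → SegmentIncreasing L′ →
             (∀ r c → segment (Rows.rowSort L r c) ≡ segment (Rows.rowSort L′ r c)) → RowIso L L′
    rowIso L L′ segment-<L segment-<L′ same = record
      { to      = transport L L′ segment-<L same
      ; from    = transport L′ L segment-<L′ same′
      ; to-from = λ x → trans (transport-rowSort L L′ segment-<L same _ _)
                              (proj₂ (Rows.rowSort-surjective L′ refl))
      ; from-to = λ x → trans (transport-rowSort L′ L segment-<L′ same′ _ _)
                              (proj₂ (Rows.rowSort-surjective L refl))
      ; row-to  = row-transport L L′ segment-<L same
      ; to-<    = transport-< L L′ segment-<L same
      ; from-<  = transport-< L′ L segment-<L′ same′
      }
      where same′ = λ r c → sym (same r c)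

    -- The elements above `x` in its part lie in earlier segments, so their images come before `f x`
    -- in a single part. There are thus at least as many elements above `f x` as above `x`; equality
    -- comes from applying the bound to the inverse as well.
    row-≤-image : ∀ (L L′ : Layout) → SegmentIncreasing L →
                  (f : Fin n → Fin n) → (∀ x → segment (f x) ≡ segment x) →
                  (∀ {x y} → Layout.col L x ≡ Layout.col L y → Layout.col L′ (f x) ≡ Layout.col L′ (f y)) →
                  ∀ x → Layout.row L x Fin.≤ Layout.row L′ (f x)
    row-≤-image L L′ segment-< f segment-f col-f x = go _ x refl
      where
      module L = Layout L
      module L′ = Layout L′
      go : ∀ k x → toℕ (L.row x) ≡ k → k ≤ toℕ (L′.row (f x))
      go zero    x rx≡ = z≤n
      go (suc k) x rx≡ =
        let k<rows = ℕ.<-trans (ℕ.≤-reflexive (sym rx≡)) (Fin.toℕ<n (L.row x))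
            k≡ = Fin.toℕ-fromℕ< k<rows
            z , rz≡ , cz≡ = L.above {fromℕ< k<rows} x
              (ℕ.≤-trans (ℕ.≤-reflexive k≡) (ℕ.≤-trans (ℕ.n≤1+n k) (ℕ.≤-reflexive (sym rx≡))))
            rz≡k = trans (cong toℕ rz≡) k≡
            sz<sx = segment-< cz≡ (ℕ.≤-trans (ℕ.≤-reflexive (cong suc rz≡k)) (ℕ.≤-reflexive (sym rx≡)))
            fz<fx = segment-reflects-< (subst₂ Fin._<_ (sym (segment-f z)) (sym (segment-f x)) sz<sx)
        in ℕ.≤-<-trans (go k z rz≡k) (L′.increasing⁻¹ (col-f cz≡) fz<fx)

    -- `f` carries row `r` onto row `r` without leaving segments, so both sorted sequences of
    -- segments have the same counts.
    rows-determined : ∀ (L L′ : Layout) (f : Fin n → Fin n) → Injective _≡_ _≡_ f →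
                      (∀ x → segment (f x) ≡ segment x) →
                      (∀ x → Layout.row L′ (f x) ≡ Layout.row L x) →
                      ∀ r c → segment (Rows.rowSort L r c) ≡ segment (Rows.rowSort L′ r c)
    rows-determined L L′ f f-inj segment-f row-f r = tabulate-injective (sorted-unique
      (AllPairs.tabulate⁺-< (segment-mono ∘ ℕ.<⇒≤ ∘ R.rowSort-< r))
      (AllPairs.tabulate⁺-< (segment-mono ∘ ℕ.<⇒≤ ∘ R′.rowSort-< r))
      λ i → begin
        count i (tabulate (segment ∘ R.rowSort r))
          ≡⟨ cong (count i) (List.tabulate-cong λ c → segment-f (R.rowSort r c)) ⟨
        count i (tabulate (segment ∘ f ∘ R.rowSort r))
          ≡⟨ cong (count i) (List.map-tabulate (f ∘ R.rowSort r) segment) ⟨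
        count i (map segment (tabulate (f ∘ R.rowSort r)))
          ≡⟨ count-↭ (↭.map⁺ segment same-row) i ⟩
        count i (map segment (tabulate (R′.rowSort r)))
          ≡⟨ cong (count i) (List.map-tabulate (R′.rowSort r) segment) ⟩
        count i (tabulate (segment ∘ R′.rowSort r)) ∎)
      where
      open ≡-Reasoning
      module L = Layout L
      module L′ = Layout L′
      module R = Rows L
      module R′ = Rows L′

      same-row : tabulate (f ∘ R.rowSort r) ↭ tabulate (R′.rowSort r)
      same-row = unique-↭
        (Unique.tabulate⁺ (increasing⇒injective (R.rowSort-< r) ∘ f-inj))
        (Unique.tabulate⁺ (increasing⇒injective (R′.rowSort-< r)))
        (λ x∈ → let c , x≡ = ∈.∈-tabulate⁻ x∈
                    d , eq = R′.rowSort-surjective (trans (row-f (R.rowSort r c)) (R.row-rowSort r c))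
                in subst (_∈ tabulate (R′.rowSort r)) (trans eq (sym x≡)) (∈.∈-tabulate⁺ d))
        (λ x∈ → let c , x≡ = ∈.∈-tabulate⁻ x∈
                    y , fy≡ = injective⇒surjective f-inj (R′.rowSort r c)
                    d , eq = R.rowSort-surjective {r} {y}
                      (trans (sym (row-f y)) (trans (cong L′.row fy≡) (R′.row-rowSort r c)))
                in subst (_∈ tabulate (f ∘ R.rowSort r)) (trans (cong f eq) (trans fy≡ (sym x≡)))
                     (∈.∈-tabulate⁺ d))

-- From semi-noncrossing tableaux to semistandard tableaux

module SemiNCT {n : ℕ} (shape : Partition n) (μ : List ℕ) (sum-μ : sum μ ≡ n) where

  open Shape shape
  open Segments μ sum-μ
  open TransversalNCT using (nct; transversal)

  layout : TransversalNCT shape μ → Layout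
  layout T = FromNCT.layout (nct T)

  -- Going down a part, segments weakly increase with the elements, and transversality excludes
  -- equality.
  segmentIncreasing : ∀ T → SegmentIncreasing μ sum-μ (layout T)
  segmentIncreasing T {x} {y} cx≡cy rx<ry = ℕ.≤∧≢⇒< (segment-mono (ℕ.<⇒≤ x<y)) λ sx≡sy →
    Fin.<⇒≢ x<y (transversal T _ _ (∈-col cx≡cy) (∈-col refl)
      (segment-≡ (Fin.toℕ-injective sx≡sy)) (∈-segment y))
    where
    open FromNCT (nct T) using (∈-col)
    x<y = Layout.increasing (layout T) cx≡cy rx<ry

  toSSYT : TransversalNCT shape μ → SSYT shape μ
  toSSYT T = RowSorted.tableau μ sum-μ (layout T) (segmentIncreasing T)

  toSSYT-row : ∀ T r (f : Fin (rowLength r) → Fin n) → (∀ {c c′} → c Fin.< c′ → f c Fin.< f c′) →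
               (∀ c → FromNCT.row (nct T) (f c) ≡ r) → (∀ {x} → FromNCT.row (nct T) x ≡ r → ∃[ c ] f c ≡ x) →
               ∀ c → SSYT.entry (toSSYT T) r c ≡ segment (f c)
  toSSYT-row T r f f-mono row-f f-surj c =
    cong segment (Rows.rowSort-unique (layout T) r f f-mono row-f f-surj c)

  -- `σ` is only known to keep segments and blocks. That it keeps rows follows from `row-≤-image`
  -- for `σ` and for its inverse.
  toSSYT-cong : ∀ {T T′} → T ∼ T′ → ∀ r c → SSYT.entry (toSSYT T) r c ≡ SSYT.entry (toSSYT T′) r c
  toSSYT-cong {T} {T′} (σ , σ∈ , τ , image) = rows-determined μ sum-μ (layout T) (layout T′)
    (σ ⟨$⟩ʳ_) (λ {x} {y} eq → trans (sym (Perm.inverseˡ σ)) (trans (cong (σ ⟨$⟩ˡ_) eq) (Perm.inverseˡ σ)))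
    segment-σ λ x → Fin.≤-antisym
      (subst (λ y → L′.row (σ ⟨$⟩ʳ x) Fin.≤ L.row y) (Perm.inverseˡ σ)
        (row-≤-image μ sum-μ (layout T′) (layout T) (segmentIncreasing T′) (σ ⟨$⟩ˡ_)
          (λ y → trans (sym (segment-σ _)) (cong segment (Perm.inverseʳ σ)))
          (λ cx≡cy → col-σ⁻¹ (trans (cong L′.col (Perm.inverseʳ σ))
            (trans cx≡cy (cong L′.col (sym (Perm.inverseʳ σ))))))
          (σ ⟨$⟩ʳ x)))
      (row-≤-image μ sum-μ (layout T) (layout T′) (segmentIncreasing T) (σ ⟨$⟩ʳ_) segment-σ
        (λ cx≡cy → trans (col-σ cx≡cy) (sym (col-σ refl))) x)
    where
    module L = Layout (layout T)
    module L′ = Layout (layout T′)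
    open FromNCT using (∈-col; col-∈)

    segment-σ : ∀ x → segment (σ ⟨$⟩ʳ x) ≡ segment x
    segment-σ x = segment-unique (Equivalence.to (σ∈ _ x) (∈-segment x))

    col-σ : ∀ {x j} → L.col x ≡ j → L′.col (σ ⟨$⟩ʳ x) ≡ τ ⟨$⟩ʳ j
    col-σ cx≡j = col-∈ (nct T′) (Equivalence.to (image _ _) (∈-col (nct T) cx≡j))

    col-σ⁻¹ : ∀ {x y} → L′.col (σ ⟨$⟩ʳ x) ≡ L′.col (σ ⟨$⟩ʳ y) → L.col x ≡ L.col y
    col-σ⁻¹ eq = col-∈ (nct T) (Equivalence.from (image _ _) (∈-col (nct T′) (trans eq (col-σ refl))))

  -- The `RowIso` obtained by matching equal places of the sorted rows is the required permutation.
  -- Since it maps parts to parts, the relabelling `τ` can be read off from one element of each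
  -- part, chosen here in the top row.
  toSSYT-injective : ∀ {T T′} → (∀ r c → SSYT.entry (toSSYT T) r c ≡ SSYT.entry (toSSYT T′) r c) → T ∼ T′
  toSSYT-injective {T} {T′} same =
      Perm.permutation to from to-from from-to
    , (λ i x → mk⇔ (λ x∈ → segment-≡ (trans (segment-to x) (segment-unique x∈)))
                   (λ x∈ → segment-≡ (trans (sym (segment-to x)) (segment-unique x∈))))
    , Perm.permutation (τ I) (τ (RowIso-sym I)) (τ-inverse (RowIso-sym I)) (τ-inverse I)
    , λ j x → mk⇔
        (λ x∈ → ∈-col (nct T′) (columns-agree I (trans (col-∈ (nct T) x∈) (sym (col-top (layout T) j)))))
        (λ x∈ → ∈-col (nct T) (trans (sym (cong L.col (from-to x)))
          (trans (columns-agree (RowIso-sym I) (col-∈ (nct T′) x∈))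
            (trans (cong L.col (from-to _)) (col-top (layout T) j)))))
    where
    module L = Layout (layout T)
    module L′ = Layout (layout T′)
    open FromNCT using (∈-col; col-∈)
    I = rowIso μ sum-μ (layout T) (layout T′) (segmentIncreasing T) (segmentIncreasing T′) same
    open RowIso I

    segment-to : ∀ x → segment (to x) ≡ segment x
    segment-to = segment-transport μ sum-μ (layout T) (layout T′) (segmentIncreasing T) same

    top : Layout → Fin columns → Fin n
    top M j = let r , j<row = firstRow j in proj₁ (Layout.place M r j j<row)

    col-top : ∀ M j → Layout.col M (top M j) ≡ j
    col-top M j = let r , j<row = firstRow j in proj₂ (proj₂ (Layout.place M r j j<row))

    τ : ∀ {M M′} → RowIso M M′ → Fin columns → Fin columns
    τ {M} {M′} J j = Layout.col M′ (RowIso.to J (top M j))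

    τ-inverse : ∀ {M M′} (J : RowIso M M′) j → τ (RowIso-sym J) (τ J j) ≡ j
    τ-inverse {M} {M′} J j = begin
      Layout.col M (RowIso.from J (top M′ (τ J j)))
        ≡⟨ columns-agree (RowIso-sym J) (col-top M′ (τ J j)) ⟩
      Layout.col M (RowIso.from J (RowIso.to J (top M j)))
        ≡⟨ cong (Layout.col M) (RowIso.from-to J (top M j)) ⟩
      Layout.col M (top M j)
        ≡⟨ col-top M j ⟩
      j ∎
      where open ≡-Reasoning

-- Matching the rows of a semistandard tableau

greatest : ∀ {P : Fin n → Set} (P? : Decidable P) → ∃ P →
           ∃[ c ] (P c × (∀ d → c Fin.< d → ¬ P d))
greatest {suc n} {P} P? (x , Px) with Fin.any? (P? ∘ suc)
... | yes above =
  let c , Pc , none = greatest (P? ∘ suc) above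
  in suc c , Pc , λ { (suc d) (s≤s c<d) → none d c<d }
greatest {suc n} P? (zero  , P0) | no none = zero , P0 , λ { (suc d) _ Pd → none (d , Pd) }
greatest {suc n} P? (suc x , Px) | no none = contradiction (x , Px) none

-- Once an opening bracket is deleted, the remaining one at index `i` had index at most `i + 1`.
punchIn-≤-suc : ∀ (c : Fin (suc n)) (i : Fin n) → toℕ (punchIn c i) ≤ suc (toℕ i)
punchIn-≤-suc zero    i       = ℕ.≤-refl
punchIn-≤-suc (suc c) zero    = z≤n
punchIn-≤-suc (suc c) (suc i) = s≤s (punchIn-≤-suc c i)

-- The brackets ) at heights v are matched, from left to right, with the last free
-- bracket ( at a smaller height u; the remaining ( are then listed in any order.
record Matching {m′ m} (m′≤m : m′ ≤ m) (u : Fin m → ℕ) (v : Fin m′ → ℕ) : Set where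
  field
    match     : Fin m → Fin m
    injective : Injective _≡_ _≡_ match
    below     : ∀ i → u (match (Fin.inject≤ i m′≤m)) < v i
    greedy    : ∀ i d → match (Fin.inject≤ i m′≤m) Fin.< d → u d < v i →
                ∃[ i′ ] (i′ Fin.< i × match (Fin.inject≤ i′ m′≤m) ≡ d)

matching : ∀ {m′ m} (m′≤m : m′ ≤ m) (u : Fin m → ℕ) (v : Fin m′ → ℕ) →
           (∀ {c d} → c Fin.≤ d → u c ≤ u d) → (∀ i → u (Fin.inject≤ i m′≤m) < v i) →
           Matching m′≤m u v
matching {zero} _ u v _ _ = record
  { match = id ; injective = id ; below = λ () ; greedy = λ () }
matching {suc m′} {suc m} m′≤m u v u-mono u<v = record
  { match = match ; injective = match-injective ; below = below ; greedy = greedy }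
  where
  first = greatest (λ d → u d ℕ.<? v zero) (zero , u<v zero)
  c = proj₁ first
  module Rest = Matching (matching (ℕ.s≤s⁻¹ m′≤m) (u ∘ punchIn c) (v ∘ suc)
    (u-mono ∘ Fin.punchIn-mono-≤ c _ _)
    -- The deletion shifts opening brackets by at most one place, and the first closing bracket is
    -- gone as well, so index `i` still finds a bracket below it.
    (λ i → ℕ.≤-<-trans (u-mono (punchIn-≤-suc c (Fin.inject≤ i (ℕ.s≤s⁻¹ m′≤m)))) (u<v (suc i))))

  match : Fin (suc m) → Fin (suc m)
  match zero    = c
  match (suc i) = punchIn c (Rest.match i)

  match-injective : Injective _≡_ _≡_ match
  match-injective {zero}  {zero}  _  = refl
  match-injective {zero}  {suc j} eq = contradiction (sym eq) (Fin.punchInᵢ≢i c _)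
  match-injective {suc i} {zero}  eq = contradiction eq (Fin.punchInᵢ≢i c _)
  match-injective {suc i} {suc j} eq = cong suc (Rest.injective (Fin.punchIn-injective c _ _ eq))

  below : ∀ i → u (match (Fin.inject≤ i m′≤m)) < v i
  below zero    = proj₁ (proj₂ first)
  below (suc i) = Rest.below i

  greedy : ∀ i d → match (Fin.inject≤ i m′≤m) Fin.< d → u d < v i →
           ∃[ i′ ] (i′ Fin.< i × match (Fin.inject≤ i′ m′≤m) ≡ d)
  greedy zero    d c<d ud<v = contradiction ud<v (proj₂ (proj₂ first) d c<d)
  greedy (suc i) d m<d ud<v with c Fin.≟ d
  ... | yes c≡d = zero , s≤s z≤n , c≡d
  ... | no c≢d =
    let eq = Fin.punchIn-punchOut c≢d
        i′ , i′<i , mi′≡ = Rest.greedy i (punchOut c≢d)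
          (ℕ.≰⇒> λ d≤m → ℕ.<⇒≱ m<d (subst (Fin._≤ punchIn c _) eq (Fin.punchIn-mono-≤ c _ _ d≤m)))
          (subst (λ d → u d < v (suc i)) (sym eq) ud<v)
    in suc i′ , s≤s i′<i , trans (cong (punchIn c) mi′≡) eq

-- Columns of index at least `m′` end in the upper row. Leaving them fixed makes `match ∘ extend`
-- send them to the unmatched brackets.
module Extension {m′ m} (m′≤m : m′ ≤ m) (h : Fin m′ → Fin m′) where

  extend : Fin m → Fin m
  extend x with toℕ x ℕ.<? m′
  ... | yes x<m′ = Fin.inject≤ (h (fromℕ< x<m′)) m′≤m
  ... | no _     = x

  extend-≡ : ∀ {x : Fin m} {i : Fin m′} → toℕ x ≡ toℕ i → extend x ≡ Fin.inject≤ (h i) m′≤m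
  extend-≡ {x} {i} x≡i with toℕ x ℕ.<? m′
  ... | yes x<m′ = cong (λ i → Fin.inject≤ (h i) m′≤m)
    (Fin.toℕ-injective (trans (Fin.toℕ-fromℕ< x<m′) x≡i))
  ... | no x≮m′ = contradiction (subst (_< m′) (sym x≡i) (Fin.toℕ<n i)) x≮m′

  extend-image : ∀ {x : Fin m} {i : Fin m′} → extend x ≡ Fin.inject≤ i m′≤m →
                 ∃[ k ] (toℕ k ≡ toℕ x × h k ≡ i)
  extend-image {x} {i} eq with toℕ x ℕ.<? m′
  ... | yes x<m′ = fromℕ< x<m′ , Fin.toℕ-fromℕ< x<m′ , Fin.inject≤-injective m′≤m m′≤m _ _ eq
  ... | no x≮m′ = contradiction
    (subst (_< m′) (trans (sym (Fin.toℕ-inject≤ i m′≤m)) (cong toℕ (sym eq))) (Fin.toℕ<n i)) x≮m′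

  extend-injective : Injective _≡_ _≡_ h → Injective _≡_ _≡_ extend
  extend-injective h-inj {x} {y} eq with toℕ y ℕ.<? m′
  ... | yes y<m′ =
    let k , k≡x , hk≡ = extend-image {x} eq
    in Fin.toℕ-injective (trans (sym k≡x) (trans (cong toℕ (h-inj hk≡)) (Fin.toℕ-fromℕ< y<m′)))
  ... | no y≮m′ with toℕ x ℕ.<? m′
  ...   | yes x<m′ = contradiction
    (subst (_< m′) (trans (sym (Fin.toℕ-inject≤ _ m′≤m)) (cong toℕ eq)) (Fin.toℕ<n (h (fromℕ< x<m′))))
    y≮m′
  ...   | no _ = eq

-- Column j meets row r in the cell numbered label r j.
record Labelling (ps : List ℕ) (e : ∀ r → Fin (lookup ps r) → ℕ) : Set where
  field
    label     : ∀ r → Fin (lookup ps r) → Fin (lookup ps r)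
    injective : ∀ r → Injective _≡_ _≡_ (label r)
    strict    : ∀ {r r′} → toℕ r′ ≡ suc (toℕ r) → ∀ j j′ → toℕ j ≡ toℕ j′ →
                e r (label r j) < e r′ (label r′ j′)
    cover     : ∀ {r r′} → toℕ r′ ≡ suc (toℕ r) → ∀ j j′ k → toℕ j ≡ toℕ j′ →
                label r j Fin.< label r k → e r (label r k) < e r′ (label r′ j′) →
                ∃[ k′ ] (toℕ k′ ≡ toℕ k × label r′ k′ Fin.< label r′ j′)

-- The last row keeps its order. In each row above, a column that continues downwards takes the
-- opening bracket matched with its closing bracket in the next row.
labelling : ∀ ps → AllPairs ℕ._≥_ ps → (e : ∀ r → Fin (lookup ps r) → ℕ) →
            (∀ r {c d} → c Fin.≤ d → e r c ≤ e r d) →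
            (∀ {r r′} → r Fin.< r′ → ∀ c c′ → toℕ c ≡ toℕ c′ → e r c < e r′ c′) →
            Labelling ps e
labelling [] _ _ _ _ = record
  { label = λ () ; injective = λ () ; strict = λ { {()} } ; cover = λ { {()} } }
labelling (p ∷ []) _ e _ _ = record
  { label     = λ _ → id
  ; injective = λ _ → id
  ; strict    = λ { {zero} {zero} () }
  ; cover     = λ { {zero} {zero} () }
  }
labelling (p ∷ q ∷ ps) ((q≤p ∷ _) ∷ ps↘) e e-mono e-strict = record
  { label = label ; injective = injective ; strict = strict ; cover = cover }
  where
  module Rest = Labelling (labelling (q ∷ ps) ps↘ (λ r → e (suc r)) (λ r → e-mono (suc r))
    (λ {r} {r′} r<r′ → e-strict {suc r} {suc r′} (s≤s r<r′)))
  module M = Matching (matching q≤p (e zero) (e (suc zero)) (e-mono zero)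
    (λ i → e-strict {zero} {suc zero} (s≤s z≤n) (Fin.inject≤ i q≤p) i (Fin.toℕ-inject≤ i q≤p)))
  open Extension q≤p (Rest.label zero)

  label : ∀ r → Fin (lookup (p ∷ q ∷ ps) r) → Fin (lookup (p ∷ q ∷ ps) r)
  label zero    = M.match ∘ extend
  label (suc r) = Rest.label r

  injective : ∀ r → Injective _≡_ _≡_ (label r)
  injective zero    = extend-injective (Rest.injective zero) ∘ M.injective
  injective (suc r) = Rest.injective r

  strict : ∀ {r r′} → toℕ r′ ≡ suc (toℕ r) → ∀ j j′ → toℕ j ≡ toℕ j′ →
           e r (label r j) < e r′ (label r′ j′)
  strict {zero} {suc zero} _ j j′ j≡j′ =
    subst (λ i → e zero (M.match i) < e (suc zero) (Rest.label zero j′))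
      (sym (extend-≡ j≡j′)) (M.below _)
  strict {suc r} {suc r′} r′≡ = Rest.strict (ℕ.suc-injective r′≡)

  cover : ∀ {r r′} → toℕ r′ ≡ suc (toℕ r) → ∀ j j′ k → toℕ j ≡ toℕ j′ →
          label r j Fin.< label r k → e r (label r k) < e r′ (label r′ j′) →
          ∃[ k′ ] (toℕ k′ ≡ toℕ k × label r′ k′ Fin.< label r′ j′)
  cover {zero} {suc zero} _ j j′ k j≡j′ j<k k<j′ =
    -- By greediness the bracket of column `k` was already taken by an earlier closing bracket `i`.
    -- Since it was taken at all, column `k` continues in the next row, and `extend-image` shows
    -- that it does so at `i`.
    let i , i<j′ , mi≡ = M.greedy (Rest.label zero j′) (label zero k)
          (subst (λ i → M.match i Fin.< label zero k) (extend-≡ j≡j′) j<k) k<j′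
        k′ , k′≡k , hk′≡i = extend-image (sym (M.injective mi≡))
    in k′ , k′≡k , subst (Fin._< Rest.label zero j′) (sym hk′≡i) i<j′
  cover {suc r} {suc r′} r′≡ = Rest.cover (ℕ.suc-injective r′≡)

-- From semistandard tableaux to semi-noncrossing tableaux

-- `ρ x` is the number of elements with a key smaller than that of `x`. With the keys below this is
-- the standardization of the tableau.
rank : ∀ {κ : Fin n → Fin k} → Injective _≡_ _≡_ κ →
       ∃[ ρ ] (Injective _≡_ _≡_ ρ × (∀ {x y} → κ x Fin.< κ y → ρ x Fin.< ρ y))
rank {n} {κ = κ} κ-inj = ρ , ρ-injective , ρ-mono
  where
  lower : Fin n → Subset n
  lower x = comprehension (λ y → κ y Fin.<? κ x)

  ∈-lower⁺ : ∀ x {y} → κ y Fin.< κ x → y Subset.∈ lower x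
  ∈-lower⁺ x = ∈-comprehension⁺ (λ y → κ y Fin.<? κ x)

  ∈-lower⁻ : ∀ x {y} → y Subset.∈ lower x → κ y Fin.< κ x
  ∈-lower⁻ x = ∈-comprehension⁻ (λ y → κ y Fin.<? κ x)

  lower<n : ∀ x → ∣ lower x ∣ < n
  lower<n x = subst (∣ lower x ∣ <_) (Subset.∣⊤∣≡n n) (Subset.p⊂q⇒∣p∣<∣q∣
    (Subset.⊆⊤ , x , Subset.∈⊤ , λ x∈ → ℕ.<-irrefl refl (∈-lower⁻ x x∈)))

  ρ : Fin n → Fin n
  ρ x = fromℕ< (lower<n x)

  ρ-mono : ∀ {x y} → κ x Fin.< κ y → ρ x Fin.< ρ y
  ρ-mono {x} {y} κx<κy = subst₂ _<_ (sym (Fin.toℕ-fromℕ< (lower<n x))) (sym (Fin.toℕ-fromℕ< (lower<n y)))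
    (Subset.p⊂q⇒∣p∣<∣q∣
      ( (λ z∈ → ∈-lower⁺ y (ℕ.<-trans (∈-lower⁻ x z∈) κx<κy))
      , x , ∈-lower⁺ y κx<κy , λ x∈ → ℕ.<-irrefl refl (∈-lower⁻ x x∈)))

  ρ-injective : Injective _≡_ _≡_ ρ
  ρ-injective {x} {y} ρx≡ρy with Fin.<-cmp (κ x) (κ y)
  ... | tri< κx<κy _ _ = contradiction ρx≡ρy (Fin.<⇒≢ (ρ-mono κx<κy))
  ... | tri≈ _ κx≡κy _ = κ-inj κx≡κy
  ... | tri> _ _ κy<κx = contradiction (sym ρx≡ρy) (Fin.<⇒≢ (ρ-mono κy<κx))

combine-monoʳ-< : ∀ (i : Fin m) {j j′ : Fin n} → j Fin.< j′ → Fin.combine i j Fin.< Fin.combine i j′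
combine-monoʳ-< i {j} {j′} j<j′ =
  subst₂ _<_ (sym (Fin.toℕ-combine i j)) (sym (Fin.toℕ-combine i j′)) (ℕ.+-monoʳ-< _ j<j′)

opposite-< : ∀ {i j : Fin n} → i Fin.< j → Fin.opposite j Fin.< Fin.opposite i
opposite-< {n} {i} {j} i<j = subst₂ _<_ (sym (Fin.opposite-prop j)) (sym (Fin.opposite-prop i))
  (ℕ.∸-monoʳ-< (s≤s i<j) (Fin.toℕ<n j))

module FromSSYT {n : ℕ} (shape : Partition n) (μ : List ℕ) (sum-μ : sum μ ≡ n) (S : SSYT shape μ) where

  open Shape shape
  open Segments μ sum-μ
  open SSYT S
  open CellNumbering (cellNumbering parts total)

  private
    rowOf : Fin n → Fin rows
    rowOf x = proj₁ (cellAt x)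

    entryOf : Fin n → Fin (length μ)
    entryOf x = entry (rowOf x) (proj₂ (cellAt x))

    -- Equal entries are numbered from the bottom row up, so that within a segment the
    -- elements of row r + 1 precede those of row r and no arc stays in the segment.
    key : Fin n → Fin (length μ ℕ.* (rows ℕ.* n))
    key x = Fin.combine (entryOf x) (Fin.combine (Fin.opposite (rowOf x)) x)

    key-injective : Injective _≡_ _≡_ key
    key-injective {x} {y} eq =
      Fin.combine-injectiveʳ (Fin.opposite (rowOf x)) x (Fin.opposite (rowOf y)) y
        (Fin.combine-injectiveʳ (entryOf x) (Fin.combine (Fin.opposite (rowOf x)) x)
                                (entryOf y) (Fin.combine (Fin.opposite (rowOf y)) y) eq)

    ranking = rank key-injective
    ρ = proj₁ ranking
    ρ-injective = proj₁ (proj₂ ranking)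
    ρ-mono = proj₂ (proj₂ ranking)

    ρ-surjective : ∀ x → ∃[ y ] ρ y ≡ x
    ρ-surjective = injective⇒surjective ρ-injective

    -- Read in the order of `ρ`, the entries increase weakly and have weight `μ`; the segments of
    -- the elements in turn do the same, so the two sequences coincide.
    segment-ρ : ∀ x → segment (ρ x) ≡ entryOf x
    segment-ρ x = sym (trans
      (cong entryOf (ρ-injective (sym (proj₂ (ρ-surjective (ρ x))))))
      (tabulate-injective entries≡segments (ρ x)))
      where
      ρ⁻¹ : Fin n → Fin n
      ρ⁻¹ x = proj₁ (ρ-surjective x)

      ρ⁻¹-injective : Injective _≡_ _≡_ ρ⁻¹
      ρ⁻¹-injective {x} {y} eq =
        trans (sym (proj₂ (ρ-surjective x))) (trans (cong ρ eq) (proj₂ (ρ-surjective y)))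

      sorted : ∀ {x y} → x Fin.< y → entryOf (ρ⁻¹ x) Fin.≤ entryOf (ρ⁻¹ y)
      sorted {x} {y} x<y = ℕ.≮⇒≥ λ ey<ex → ℕ.<-asym x<y
        (subst₂ Fin._<_ (proj₂ (ρ-surjective y)) (proj₂ (ρ-surjective x))
          (ρ-mono (Fin.combine-monoˡ-< _ _ ey<ex)))

      entries≡segments : tabulate (entryOf ∘ ρ⁻¹) ≡ tabulate segment
      entries≡segments = sorted-unique (AllPairs.tabulate⁺-< sorted)
        (AllPairs.tabulate⁺-< (segment-mono ∘ ℕ.<⇒≤)) λ i → begin
          count i (tabulate (entryOf ∘ ρ⁻¹))     ≡⟨ cong (count i) (List.map-tabulate ρ⁻¹ entryOf) ⟨
          count i (map entryOf (tabulate ρ⁻¹))   ≡⟨ count-↭ (↭.map⁺ entryOf (tabulate-↭ ρ⁻¹-injective)) i ⟩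
          count i (map entryOf (allFin n))       ≡⟨ cong (count i) (List.map-tabulate id entryOf) ⟩
          count i (tabulate entryOf)             ≡⟨ cong (count i) (reading-word entry) ⟨
          count i entries                        ≡⟨ weight i ⟩
          lookup μ i                             ≡⟨ count-segment i ⟨
          count i (tabulate segment)             ∎
        where open ≡-Reasoning

    sorted-row : ∀ r → Fin (rowLength r) → Fin n
    sorted-row r c = ρ (number (r , c))

    segment-sorted-row : ∀ r c → segment (sorted-row r c) ≡ entry r c
    segment-sorted-row r c = trans (segment-ρ _) (cong (λ (r , c) → entry r c) (cellAt-number (r , c)))

    tieBreak : ∀ r → Fin (rowLength r) → Fin (rows ℕ.* n)
    tieBreak r c = Fin.combine (Fin.opposite r) (number (r , c))

    key-number : ∀ r c → key (number (r , c)) ≡ Fin.combine (entry r c) (tieBreak r c)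
    key-number r c = cong
      (λ (r′ , c′) → Fin.combine (entry r′ c′) (Fin.combine (Fin.opposite r′) (number (r , c))))
      (cellAt-number (r , c))

    key-< : ∀ {r c r′ c′} →
            Fin.combine (entry r c) (tieBreak r c) Fin.< Fin.combine (entry r′ c′) (tieBreak r′ c′) →
            sorted-row r c Fin.< sorted-row r′ c′
    key-< {r} {c} {r′} {c′} lt = ρ-mono (subst₂ Fin._<_ (sym (key-number r c)) (sym (key-number r′ c′)) lt)

    tieBreak-< : ∀ {r c r′ c′} → entry r c ≡ entry r′ c′ → tieBreak r c Fin.< tieBreak r′ c′ →
                 sorted-row r c Fin.< sorted-row r′ c′
    tieBreak-< {r} {c} {r′} {c′} e≡e′ lt = key-< (subst
      (λ i → Fin.combine (entry r c) (tieBreak r c) Fin.< Fin.combine i (tieBreak r′ c′))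
      e≡e′ (combine-monoʳ-< (entry r c) lt))

    entry-< : ∀ {r c r′ c′} → entry r c Fin.< entry r′ c′ → sorted-row r c Fin.< sorted-row r′ c′
    entry-< e<e′ = key-< (Fin.combine-monoˡ-< _ _ e<e′)

    sorted-row-< : ∀ r {c c′} → c Fin.< c′ → sorted-row r c Fin.< sorted-row r c′
    sorted-row-< r {c} {c′} c<c′ with Fin.<-cmp (entry r c) (entry r c′)
    ... | tri< e<e′ _ _ = entry-< e<e′
    ... | tri≈ _ e≡e′ _ = tieBreak-< e≡e′ (combine-monoʳ-< (Fin.opposite r) (number-< r c<c′))
    ... | tri> _ _ e′<e = contradiction (rowsWeaklyIncrease r (ℕ.<⇒≤ c<c′)) (ℕ.<⇒≱ e′<e)

    -- With equal entries the lower row comes first, so an upper element that precedes a lower one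
    -- has a strictly smaller entry. The strict inequality used by the matching is thus the order of
    -- the elements.
    sorted-row-<⁻¹ : ∀ {r r′} → r Fin.< r′ → ∀ {c c′} →
                     sorted-row r c Fin.< sorted-row r′ c′ → entry r c Fin.< entry r′ c′
    sorted-row-<⁻¹ {r} {r′} r<r′ {c} {c′} x<y with Fin.<-cmp (entry r c) (entry r′ c′)
    ... | tri< e<e′ _ _ = e<e′
    ... | tri≈ _ e≡e′ _ = contradiction x<y (ℕ.<-asym (tieBreak-< (sym e≡e′)
      (Fin.combine-monoˡ-< _ _ (opposite-< r<r′))))
    ... | tri> _ _ e′<e = contradiction x<y (ℕ.<-asym (entry-< e′<e))

    open Labelling (labelling parts parts-decreasing (λ r c → toℕ (entry r c)) rowsWeaklyIncrease
      (λ {r} {r′} → columnsStrictlyIncrease {r} {r′}))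
      using (label) renaming (injective to label-injective; strict to label-adjacent; cover to label-cover)

    -- Adjacent rows are chained along the column, whose intermediate cells exist because higher
    -- rows are at least as long.
    label-strict : ∀ {r r′} → r Fin.< r′ → ∀ j j′ → toℕ j ≡ toℕ j′ →
                   entry r (label r j) Fin.< entry r′ (label r′ j′)
    label-strict {r} {r′} r<r′ j j′ j≡j′ = go (toℕ r′) refl r<r′ j′ j≡j′
      where
      go : ∀ k {r′} → toℕ r′ ≡ k → toℕ r < k → ∀ j′ → toℕ j ≡ toℕ j′ →
           entry r (label r j) Fin.< entry r′ (label r′ j′)
      go (suc k) {r′} r′≡ r<1+k j′ j≡j′ with ℕ.<-cmp (toℕ r) k
      ... | tri≈ _ r≡k _ = label-adjacent (trans r′≡ (cong suc (sym r≡k))) j j′ j≡j′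
      ... | tri> _ _ k<r = contradiction r<1+k (ℕ.<⇒≱ (s≤s k<r))
      ... | tri< r<k _ _ = ℕ.<-trans
        (go k q≡ r<k (fromℕ< j′<q) (trans j≡j′ (sym (Fin.toℕ-fromℕ< j′<q))))
        (label-adjacent (trans r′≡ (cong suc (sym q≡))) (fromℕ< j′<q) j′ (Fin.toℕ-fromℕ< j′<q))
        where
        k<rows : k < rows
        k<rows = ℕ.<-trans (ℕ.≤-reflexive (sym r′≡)) (Fin.toℕ<n r′)
        q : Fin rows
        q = fromℕ< k<rows
        q≡ : toℕ q ≡ k
        q≡ = Fin.toℕ-fromℕ< k<rows
        j′<q : toℕ j′ < rowLength q
        j′<q = ℕ.<-≤-trans (Fin.toℕ<n j′) (rowLength-antitone
          (ℕ.≤-trans (ℕ.≤-reflexive q≡) (ℕ.≤-trans (ℕ.n≤1+n k) (ℕ.≤-reflexive (sym r′≡)))))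

    element : ∀ r → Fin (rowLength r) → Fin n
    element r j = sorted-row r (label r j)

    locate : ∀ x → ∃[ r ] ∃[ j ] element r j ≡ x
    locate x =
      let y , ρy≡x = ρ-surjective x
          r , c = cellAt y
          j , lj≡c = injective⇒surjective (label-injective r) c
      in r , j , trans (cong (sorted-row r) lj≡c) (trans (cong ρ (number-cellAt y)) ρy≡x)

    element-injective : ∀ {s t : Cell parts} →
                        element (proj₁ s) (proj₂ s) ≡ element (proj₁ t) (proj₂ t) → s ≡ t
    element-injective {r , j} {r′ , j′} eq
      with trans (sym (cellAt-number (r , label r j)))
             (trans (cong cellAt (ρ-injective eq)) (cellAt-number (r′ , label r′ j′)))
    ... | cells≡ with refl ← cong proj₁ cells≡ = cong (r ,_) (label-injective r (,-injectiveʳ cells≡))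

    row : Fin n → Fin rows
    row x = proj₁ (locate x)

    slot : ∀ x → Fin (rowLength (row x))
    slot x = proj₁ (proj₂ (locate x))

    element-slot : ∀ x → element (row x) (slot x) ≡ x
    element-slot x = proj₂ (proj₂ (locate x))

    row-element : ∀ r j → row (element r j) ≡ r
    row-element r j = cong proj₁ (element-injective (element-slot (element r j)))

    toℕ-slot-element : ∀ r j → toℕ (slot (element r j)) ≡ toℕ j
    toℕ-slot-element r j = cong (λ (_ , j) → toℕ j)
      (element-injective {_ , slot (element r j)} {r , j} (element-slot (element r j)))

    col : Fin n → Fin columns
    col x = Fin.inject≤ (slot x) (rowLength≤columns (row x))

    toℕ-col : ∀ x → toℕ (col x) ≡ toℕ (slot x)
    toℕ-col x = Fin.toℕ-inject≤ (slot x) (rowLength≤columns (row x))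

    slot-≡ : ∀ {x y} → col x ≡ col y → toℕ (slot x) ≡ toℕ (slot y)
    slot-≡ {x} {y} cx≡cy = trans (sym (toℕ-col x)) (trans (cong toℕ cx≡cy) (toℕ-col y))

    segment-element : ∀ x → segment x ≡ entry (row x) (label (row x) (slot x))
    segment-element x = trans (cong segment (sym (element-slot x))) (segment-sorted-row _ _)

    segment-< : ∀ {x y} → col x ≡ col y → row x Fin.< row y → segment x Fin.< segment y
    segment-< {x} {y} cx≡cy rx<ry = subst₂ Fin._<_ (sym (segment-element x)) (sym (segment-element y))
      (label-strict rx<ry (slot x) (slot y) (slot-≡ cx≡cy))

    separate : ∀ {x y} → row x ≡ row y → col x ≡ col y → x ≡ y
    separate {x} {y} rx≡ry cx≡cy =
      trans (sym (element-slot x)) (trans (same rx≡ry (slot-≡ cx≡cy)) (element-slot y))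
      where
      same : ∀ {r r′ j j′} → r ≡ r′ → toℕ j ≡ toℕ j′ → element r j ≡ element r′ j′
      same refl j≡j′ = cong (element _) (Fin.toℕ-injective j≡j′)

    place : ∀ r j → toℕ j < rowLength r → ∃[ x ] (row x ≡ r × col x ≡ j)
    place r j j<row = element r i , row-element r i
      , Fin.toℕ-injective (trans (toℕ-col _) (trans (toℕ-slot-element r i) (Fin.toℕ-fromℕ< j<row)))
      where i = fromℕ< j<row

    -- Translates the covering property of the labels: `x < z` compares labels inside a row, and
    -- `z < y` compares entries of adjacent rows.
    cover : ∀ {x y z} → col x ≡ col y → toℕ (row y) ≡ suc (toℕ (row x)) →
            row z ≡ row x → x Fin.< z → z Fin.< y →
            ∃[ w ] (col w ≡ col z × row w ≡ row y × w Fin.< y)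
    cover {x} {y} {z} cx≡cy ry≡ rz≡rx x<z z<y =
      let k′ , k′≡i , k′<j′ = label-cover {row x} {row y} ry≡ (slot x) (slot y) i (slot-≡ cx≡cy)
            (increasing-reflects (sorted-row-< (row x)) (subst₂ Fin._<_ (sym (element-slot x)) (sym eᵢ≡z) x<z))
            (sorted-row-<⁻¹ (ℕ.≤-reflexive (sym ry≡)) (subst₂ Fin._<_ (sym eᵢ≡z) (sym (element-slot y)) z<y))
      in element (row y) k′
       , Fin.toℕ-injective (trans (toℕ-col _) (trans (toℕ-slot-element (row y) k′)
           (trans k′≡i (trans (sym i≡) (sym (toℕ-col z))))))
       , row-element (row y) k′
       , subst (element (row y) k′ Fin.<_) (element-slot y) (sorted-row-< (row y) k′<j′)
      where
      moved : ∀ {r} → row z ≡ r → Σ (Fin (rowLength r)) λ i → element r i ≡ z × toℕ (slot z) ≡ toℕ i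
      moved refl = slot z , element-slot z , refl
      i : Fin (rowLength (row x))
      i = proj₁ (moved rz≡rx)
      eᵢ≡z = proj₁ (proj₂ (moved rz≡rx))
      i≡ = proj₂ (proj₂ (moved rz≡rx))

    layout : Layout
    layout = record
      { row        = row
      ; col        = col
      ; fits       = λ x → subst (_< rowLength (row x)) (sym (toℕ-col x)) (Fin.toℕ<n (slot x))
      ; place      = place
      ; separate   = separate
      ; increasing = λ cx≡cy rx<ry → segment-reflects-< (segment-< cx≡cy rx<ry)
      ; cover      = cover
      }

    module F = FromLayout layout

    transversal : Transversal μ F.nct
    transversal j i {x} {y} x∈ y∈ x∈i y∈i with Fin.<-cmp (row x) (row y)
    ... | tri≈ _ rx≡ry _ = separate rx≡ry (trans (F.∈-part⁻ x∈) (sym (F.∈-part⁻ y∈)))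
    ... | tri< rx<ry _ _ = contradiction (trans (segment-unique x∈i) (sym (segment-unique y∈i)))
      (Fin.<⇒≢ (segment-< (trans (F.∈-part⁻ x∈) (sym (F.∈-part⁻ y∈))) rx<ry))
    ... | tri> _ _ ry<rx = contradiction (trans (segment-unique y∈i) (sym (segment-unique x∈i)))
      (Fin.<⇒≢ (segment-< (trans (F.∈-part⁻ y∈) (sym (F.∈-part⁻ x∈))) ry<rx))

  semiNCT : TransversalNCT shape μ
  semiNCT = record { nct = F.nct ; transversal = transversal }

  open SemiNCT shape μ sum-μ using (toSSYT; toSSYT-row)

  private
    row-sorted : ∀ r c → row (sorted-row r c) ≡ r
    row-sorted r c = let j , lj≡c = injective⇒surjective (label-injective r) c in
      trans (cong (row ∘ sorted-row r) (sym lj≡c)) (row-element r j)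

    sorted-surjective : ∀ {r} x → row x ≡ r → ∃[ c ] sorted-row r c ≡ x
    sorted-surjective x refl = label (row x) (slot x) , element-slot x

  -- The rows of the layout, sorted, are the `sorted-row`s, and `ρ` sends each cell into the segment
  -- named by its entry.
  toSSYT-semiNCT : ∀ r c → SSYT.entry (toSSYT semiNCT) r c ≡ entry r c
  toSSYT-semiNCT r c = trans
    (toSSYT-row semiNCT r (sorted-row r) (sorted-row-< r)
      (λ c → trans (F.row-nct (sorted-row r c)) (row-sorted r c))
      (λ {x} rx≡r → sorted-surjective x (trans (sym (F.row-nct x)) rx≡r)) c)
    (segment-sorted-row r c)

-- Counting

-- The codes satisfying `P`, in increasing order, enumerate `S`. Proofs of `P` may differ, so the
-- hypotheses on `decode` range over all of them.
hasCardinality : (S : Setoid 0ℓ 0ℓ) → let open Setoid S in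
                 {P : Fin k → Set} (P? : Decidable P)
                 (decode : ∀ {x} → P x → Carrier) (encode : Carrier → Fin k) →
                 (∀ {x y} {p : P x} {q : P y} → decode p ≈ decode q → x ≡ y) →
                 (∀ T → P (encode T)) → (∀ T (p : P (encode T)) → decode p ≈ T) →
                 ∃[ N ] HasCardinality S N
hasCardinality {k} S {P} P? decode encode decode-injective encode-P decode-encode = length codes , record
  { to        = λ i → decode (holds i)
  ; cong      = λ { refl → Setoid.refl S }
  ; bijective = (λ eq → increasing⇒injective (lookup-increasing codes (filter-increasing P?))
                          (decode-injective eq))
              , λ T → let T∈ = ∈-filter-allFin P? (encode-P T) in
                  Any.index T∈ , λ { refl → recovers T (holds (Any.index T∈)) (sym (Any.lookup-index T∈)) }
  }
  where
  open Setoid S using (_≈_)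
  codes : List (Fin k)
  codes = filter P? (allFin k)

  holds : ∀ i → P (lookup codes i)
  holds i = filter-allFin-holds P? (∈.∈-lookup {xs = codes} i)

  recovers : ∀ T {x} (p : P x) → x ≡ encode T → decode p ≈ T
  recovers T p refl = decode-encode T p

module _ {n : ℕ} (shape : Partition n) (μ : List ℕ) where

  open Shape shape
  open CellNumbering (cellNumbering parts total)

  private
    K = length μ

    Semistandard : (∀ r → Fin (rowLength r) → Fin K) → Set
    Semistandard e =
      (∀ r c c′ → c Fin.≤ c′ → e r c Fin.≤ e r c′) ×
      (∀ r r′ → r Fin.< r′ → ∀ c c′ → toℕ c ≡ toℕ c′ → e r c Fin.< e r′ c′) ×
      (∀ i → count i (concat (tabulate λ r → tabulate (e r))) ≡ lookup μ i)

    semistandard? : ∀ e → Dec (Semistandard e)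
    semistandard? e =
      Fin.all? (λ r → Fin.all? λ c → Fin.all? λ c′ → (c Fin.≤? c′) →-dec (e r c Fin.≤? e r c′)) ×-dec
      Fin.all? (λ r → Fin.all? λ r′ → (r Fin.<? r′) →-dec
        Fin.all? λ c → Fin.all? λ c′ → (toℕ c ℕ.≟ toℕ c′) →-dec (e r c Fin.<? e r′ c′)) ×-dec
      Fin.all? (λ i → _ ℕ.≟ _)

    semistandard-cong : ∀ {e f} → (∀ r c → e r c ≡ f r c) → Semistandard e → Semistandard f
    semistandard-cong e≡f (weak , strict , weight) =
        (λ r c c′ c≤c′ → subst₂ Fin._≤_ (e≡f r c) (e≡f r c′) (weak r c c′ c≤c′))
      , (λ r r′ r<r′ c c′ c≡c′ → subst₂ Fin._<_ (e≡f r c) (e≡f r′ c′) (strict r r′ r<r′ c c′ c≡c′))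
      , λ i → trans (cong (count i ∘ concat)
                (List.tabulate-cong λ r → List.tabulate-cong λ c → sym (e≡f r c))) (weight i)

    -- A filling of the n cells is a function from cell numbers to K values, hence one of `K ^ n`
    -- codes.
    decode : Fin (K ℕ.^ n) → ∀ r → Fin (rowLength r) → Fin K
    decode x r c = Fin.finToFun x (number (r , c))

    encode : SSYT shape μ → Fin (K ℕ.^ n)
    encode T = Fin.funToFin (λ x → SSYT.entry T (proj₁ (cellAt x)) (proj₂ (cellAt x)))

    decode-injective : ∀ {x y} → (∀ r c → decode x r c ≡ decode y r c) → x ≡ y
    decode-injective {x} {y} eq = begin
      x
        ≡⟨ Fin.funToFin-finToFin {n} x ⟨
      Fin.funToFin {n} (Fin.finToFun x)
        ≡⟨ funToFin-cong (λ i → subst (λ i → Fin.finToFun x i ≡ Fin.finToFun y i) (number-cellAt i) (eq _ _)) ⟩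
      Fin.funToFin {n} (Fin.finToFun y)
        ≡⟨ Fin.funToFin-finToFin {n} y ⟩
      y ∎
      where
      open ≡-Reasoning
      funToFin-cong : ∀ {m k} {f g : Fin m → Fin k} → (∀ i → f i ≡ g i) → Fin.funToFin f ≡ Fin.funToFin g
      funToFin-cong {zero}  f≡g = refl
      funToFin-cong {suc m} f≡g = cong₂ Fin.combine (f≡g zero) (funToFin-cong (f≡g ∘ suc))

    decode-encode : ∀ T r c → decode (encode T) r c ≡ SSYT.entry T r c
    decode-encode T r c = trans (Fin.finToFun-funToFin {n} _ (number (r , c)))
      (cong (λ (r , c) → SSYT.entry T r c) (cellAt-number (r , c)))

  ssyt-finite : ∃[ N ] HasCardinality (ssytSetoid shape μ) N
  ssyt-finite = hasCardinality (ssytSetoid shape μ) (λ x → semistandard? (decode x))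
    (λ {x} (weak , strict , weight) → record
      { entry = decode x
      ; rowsWeaklyIncrease = λ r → weak r _ _
      ; columnsStrictlyIncrease = strict _ _
      ; weight = weight
      })
    encode decode-injective
    (λ T → let open SSYT T in semistandard-cong (λ r c → sym (decode-encode T r c))
      ((λ r _ _ → rowsWeaklyIncrease r) , (λ _ _ → columnsStrictlyIncrease) , weight))
    (λ T _ → decode-encode T)

theorem13 : ∀ {n : ℕ} (shape : Partition n) (μ : List ℕ) → sum μ ≡ n →
    ∃[ N ] (HasCardinality (ssytSetoid shape μ) N × HasCardinality (semiNCTSetoid shape μ) N)
theorem13 {n} shape μ sum-μ with N , ssyts ← ssyt-finite shape μ = N , ssyts , record
  { to        = semiNCT ∘ S
  ; cong      = λ { {i} refl → toSSYT-injective {semiNCT (S i)} {semiNCT (S i)} λ _ _ → refl }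
  ; bijective =
      (λ {i} {j} T∼T′ → proj₁ bijective λ r c → trans (sym (toSSYT-semiNCT (S i) r c))
        (trans (toSSYT-cong {semiNCT (S i)} {semiNCT (S j)} T∼T′ r c) (toSSYT-semiNCT (S j) r c)))
    -- The preimage of `T` is the index of its own tableau: the blocks rebuilt from that tableau
    -- have the same tableau as `T`, hence are equivalent to `T`.
    , λ T → let i , to≈ = proj₂ bijective (toSSYT T) in
        i , λ { refl → toSSYT-injective {semiNCT (S i)} {T} λ r c →
                  trans (toSSYT-semiNCT (S i) r c) (to≈ refl r c) }
  }
  where
  open Bijection ssyts using (bijective) renaming (to to S)
  open SemiNCT shape μ sum-μ
  open FromSSYT shape μ sum-μ
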